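{- There exists a constant $c$ such that for every integer $d \ge 2$, the $d$-dimensional hypercube $H_d$ satisfies $\mathrm{box}(H_d) \le \frac{c\,d}{\log d}$.
   Context: The $d$-dimensional hypercube $H_d$ is the graph whose vertices correspond to the $2^d$ binary strings of length $d$, two vertices being adjacent if and only if the corresponding strings differ in exactly one bit position. A $k$-dimensional (axis-parallel) box is a Cartesian product $R_1 \times R_2 \times \cdots \times R_k$ where each $R_i$ is a closed interval of the form $[a_i, b_i]$ on the real line. A finite simple graph $G$ is representable as the intersection graph of a family of sets $(S_x)_{x \in V(G)}$ if two distinct vertices $x,y$ are adjacent in $G$ if and only if $S_x \cap S_y \neq \emptyset$. The boxicity $\mathrm{box}(G)$ is the minimum $k$ such that $G$ is representable as the intersection graph of axis-parallel boxes in $k$-dimensional space. -}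

module Defs where

open import Data.Bool.Base using (Bool; true)
import Data.Bool.Properties as Bool
open import Data.Fin.Base using (Fin; zero; suc; toℕ; fromℕ<)
open import Data.Fin.Properties using (2↔Bool; *↔×; toℕ-fromℕ<; all?; any?; sequence)
import Data.Fin.Properties as Fin
open import Data.Fin.Subset using (Subset; ∣_∣) renaming (_∈_ to _∈ˢ_)
open import Data.Fin.Subset.Properties using (∣p∣≤n; p⊆q⇒∣p∣≤∣q∣; p⊂q⇒∣p∣<∣q∣)
open import Data.Integer.Base as ℤ using (ℤ; +_; -[1+_])
import Data.Integer.Properties as ℤ
open import Data.Nat.Base as ℕ using (ℕ; zero; suc; z≤n; s≤s; NonZero)
import Data.Nat.Properties as ℕ
open import Data.Nat.Coprimality using (1-coprimeTo) renaming (sym to coprime-sym)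
open import Data.Nat.Solver using (module +-*-Solver)
open import Data.Product.Base using (Σ-syntax; ∃; ∃-syntax; _×_; _,_; proj₁; proj₂)
open import Data.Product using (∃!)
open import Data.Product.Function.NonDependent.Propositional using (_×-↔_)
open import Data.Rational.Base as ℚ using (ℚ; mkℚ; 0ℚ; 1ℚ; ↥_; ↧ₙ_; 1/_)
import Data.Rational.Properties as ℚ
open import Data.Sum.Base as Sum using (_⊎_; inj₁; inj₂)
open import Data.Vec.Base using (Vec; []; _∷_; lookup; tabulate)
open import Data.Vec.Properties using (lookup∘tabulate; []=⇒lookup; lookup⇒[]=)
open import Effect.Monad using (RawMonad)
open import Function.Base using (_∘_)
open import Function.Bundles using (_⇔_; mk⇔; Equivalence; _↔_; mk↔ₛ′; Inverse)
open import Function.Properties.Inverse using (↔-sym; ↔-trans)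
open import Level using (0ℓ; _⊔_)
open import Relation.Binary.Definitions using (Symmetric; Decidable)
open import Relation.Binary.PropositionalEquality
  using (_≡_; _≢_; refl; sym; trans; cong; cong₂; subst; subst₂)
open import Relation.Nullary using (¬_; Dec; yes; no; does; contradiction)
open import Relation.Nullary.Decidable
  using (map′; ¬?; _×-dec_; _→-dec_; ¬¬-excluded-middle; decidable-stable; dec-true)
open import Relation.Nullary.Negation using (¬¬-Monad)
open import Relation.Unary using (Pred; _≬_)

------------------------------------------------------------------------
-- Real numbers: two-sided, located Dedekind cuts of ℚ

record ℝ : Set₁ where
  field
    Lower Upper    : Pred ℚ 0ℓ
    lower-nonempty : ∃ Lower
    upper-nonempty : ∃ Upper
    lower-closed   : ∀ {p q} → p ℚ.< q → Lower q → Lower p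
    upper-closed   : ∀ {p q} → p ℚ.< q → Upper p → Upper q
    lower-open     : ∀ {q} → Lower q → ∃[ r ] q ℚ.< r × Lower r
    upper-open     : ∀ {q} → Upper q → ∃[ r ] r ℚ.< q × Upper r
    disjoint       : ∀ {q} → Lower q → ¬ Upper q
    located        : ∀ {p q} → p ℚ.< q → Lower p ⊎ Upper q

open ℝ public

infix 4 _≤ʳ_

_≤ʳ_ : ℝ → ℝ → Set
x ≤ʳ y = ∀ q → Lower x q → Lower y q

≤ʳ-refl : ∀ x → x ≤ʳ x
≤ʳ-refl x q Lq = Lq

≤ʳ-trans : ∀ x y z → x ≤ʳ y → y ≤ʳ z → x ≤ʳ z
≤ʳ-trans x y z x≤y y≤z q = y≤z q ∘ x≤y q

lower<upper : ∀ x {p q} → Lower x p → Upper x q → p ℚ.< q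
lower<upper x {p} {q} Lp Uq with q ℚ.≤? p
... | no  q≰p = ℚ.≰⇒> q≰p
... | yes q≤p with r , r<q , Ur ← upper-open x Uq
  = contradiction (upper-closed x (ℚ.<-≤-trans r<q q≤p) Ur) (disjoint x Lp)

≰ʳ⇒≥ʳ : ∀ x y → ¬ (x ≤ʳ y) → y ≤ʳ x
≰ʳ⇒≥ʳ x y x≰y p Lp with lower-open y Lp
... | r , p<r , Lr with located x p<r
...   | inj₁ Lxp = Lxp
...   | inj₂ Uxr = contradiction
  (λ q Lxq → lower-closed y (lower<upper x Lxq Uxr) Lr) x≰y

-- The real number separating A from B; A and B need not be open or closed
-- under <, since Lower and Upper are generated from them.
cut : (A B : Pred ℚ 0ℓ) → ∃ A → ∃ B →
      (∀ {r s} → A r → B s → r ℚ.≤ s) →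
      (∀ {p q} → p ℚ.< q → (∃[ r ] p ℚ.≤ r × A r) ⊎ (∃[ s ] s ℚ.≤ q × B s)) → ℝ
cut A B (a , Aa) (b , Bb) A≤B loc = record
  { Lower          = λ q → ∃[ r ] q ℚ.< r × A r
  ; Upper          = λ q → ∃[ r ] r ℚ.< q × B r
  ; lower-nonempty = a ℚ.- 1ℚ , a , a-1<a , Aa
  ; upper-nonempty = b ℚ.+ 1ℚ , b , b<b+1 , Bb
  ; lower-closed   = λ p<q (r , q<r , Ar) → r , ℚ.<-trans p<q q<r , Ar
  ; upper-closed   = λ p<q (r , r<p , Br) → r , ℚ.<-trans r<p p<q , Br
  ; lower-open     = λ (r , q<r , Ar) → let s , q<s , s<r = ℚ.<-dense q<r
                                        in s , q<s , r , s<r , Ar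
  ; upper-open     = λ (r , r<q , Br) → let s , r<s , s<q = ℚ.<-dense r<q
                                        in s , s<q , r , r<s , Br
  ; disjoint       = λ (r , q<r , Ar) (s , s<q , Bs) →
      contradiction (ℚ.<-≤-trans (ℚ.<-trans s<q q<r) (A≤B Ar Bs)) (ℚ.<-irrefl refl)
  ; located        = λ p<q → let r , p<r , r<q = ℚ.<-dense p<q
                                 s , r<s , s<q = ℚ.<-dense r<q
                             in Sum.map
                                  (λ (t , r≤t , At) → t , ℚ.<-≤-trans p<r r≤t , At)
                                  (λ (t , t≤s , Bt) → t , ℚ.≤-<-trans t≤s s<q , Bt)
                                  (loc r<s)
  }
  where
  a-1<a : a ℚ.- 1ℚ ℚ.< a
  a-1<a = subst (a ℚ.- 1ℚ ℚ.<_) (ℚ.+-identityʳ a) (ℚ.+-monoʳ-< a (ℚ.negative⁻¹ (ℚ.- 1ℚ)))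

  b<b+1 : b ℚ.< b ℚ.+ 1ℚ
  b<b+1 = subst (ℚ._< b ℚ.+ 1ℚ) (ℚ.+-identityʳ b) (ℚ.+-monoʳ-< b (ℚ.positive⁻¹ 1ℚ))

fromℚ : ℚ → ℝ
fromℚ a = cut (ℚ._≤ a) (a ℚ.≤_) (a , ℚ.≤-refl) (a , ℚ.≤-refl) ℚ.≤-trans
  (λ {p} p<q → Sum.map (λ p≤a → p , ℚ.≤-refl , p≤a) (λ a≤p → p , ℚ.<⇒≤ p<q , a≤p)
                       (ℚ.≤-total p a))

ℕ→ℚ : ℕ → ℚ
ℕ→ℚ n = mkℚ (+ n) 0 (coprime-sym (1-coprimeTo n))

-- The product of a natural number and a real number.
infixl 7 _·_

_·_ : ℕ → ℝ → ℝ
n · x = cut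
  (λ s → ∃[ r ] Lower x r × s ≡ ℕ→ℚ n ℚ.* r)
  (λ s → ∃[ r ] Upper x r × s ≡ ℕ→ℚ n ℚ.* r)
  (_ , proj₁ (lower-nonempty x) , proj₂ (lower-nonempty x) , refl)
  (_ , proj₁ (upper-nonempty x) , proj₂ (upper-nonempty x) , refl)
  (λ { (_ , Lr , refl) (_ , Us , refl) →
         ℚ.*-monoˡ-≤-nonNeg (ℕ→ℚ n) (ℚ.<⇒≤ (lower<upper x Lr Us)) })
  (loc n)
  where
  loc : ∀ n {p q} → p ℚ.< q →
        (∃[ s ] p ℚ.≤ s × ∃[ r ] Lower x r × s ≡ ℕ→ℚ n ℚ.* r) ⊎
        (∃[ s ] s ℚ.≤ q × ∃[ r ] Upper x r × s ≡ ℕ→ℚ n ℚ.* r)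
  loc zero {p} {q} p<q with p ℚ.≤? 0ℚ
  ... | yes p≤0 = let r , Lr = lower-nonempty x in
                  inj₁ (0ℚ , p≤0 , r , Lr , sym (ℚ.*-zeroˡ r))
  ... | no  p≰0 = let r , Ur = upper-nonempty x in
                  inj₂ (0ℚ , ℚ.<⇒≤ (ℚ.<-trans (ℚ.≰⇒> p≰0) p<q) , r , Ur , sym (ℚ.*-zeroˡ r))
  loc n@(suc _) {p} {q} p<q =
    Sum.map (λ Lr → p , ℚ.≤-refl , _ , Lr , sym (cancel p))
            (λ Ur → q , ℚ.≤-refl , _ , Ur , sym (cancel q))
            (located x (ℚ.*-monoʳ-<-pos (1/ ℕ→ℚ n) {{pos-1/n}} p<q))
    where
    pos-1/n : ℚ.Positive (1/ ℕ→ℚ n)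
    pos-1/n = ℚ.1/pos⇒pos (ℕ→ℚ n)

    cancel : ∀ p → ℕ→ℚ n ℚ.* (1/ ℕ→ℚ n ℚ.* p) ≡ p
    cancel p = trans (sym (ℚ.*-assoc (ℕ→ℚ n) (1/ ℕ→ℚ n) p))
                     (trans (cong (ℚ._* p) (ℚ.*-inverseʳ (ℕ→ℚ n))) (ℚ.*-identityˡ p))

-- For r = i/n, the inequality 2^r ≤ d means 2^i ≤ d^n in ℚ, and similarly
-- d ≤ 2^r means d^n ≤ 2^i; writing i = i⁺ - i⁻ these become inequalities in ℕ.

infix 9 _⁺ _⁻

_⁺ _⁻ : ℤ → ℕ
(+ n)    ⁺ = n
-[1+ n ] ⁺ = 0
(+ n)    ⁻ = 0
-[1+ n ] ⁻ = suc n

2^_≤_ : ℚ → ℕ → Set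
2^ r ≤ d = 2 ℕ.^ (↥ r) ⁺ ℕ.≤ d ℕ.^ (↧ₙ r) ℕ.* 2 ℕ.^ (↥ r) ⁻

_≤2^_ : ℕ → ℚ → Set
d ≤2^ r = d ℕ.^ (↧ₙ r) ℕ.* 2 ℕ.^ (↥ r) ⁻ ℕ.≤ 2 ℕ.^ (↥ r) ⁺

n≤2^n : ∀ n → n ℕ.≤ 2 ℕ.^ n
n≤2^n zero    = z≤n
n≤2^n (suc n) = ℕ.+-mono-≤ (ℕ.m^n>0 2 n) (ℕ.≤-trans (n≤2^n n) (ℕ.m≤m+n _ _))

^-cancelʳ-≤ : ∀ {m n} → 2 ℕ.^ m ℕ.≤ 2 ℕ.^ n → m ℕ.≤ n
^-cancelʳ-≤ 2^m≤2^n = ℕ.≮⇒≥ (λ n<m →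
  ℕ.<⇒≱ (ℕ.^-monoʳ-< 2 (s≤s (s≤s z≤n)) n<m) 2^m≤2^n)

⁺⁻-cancel-≤ : ∀ i j m n .{{_ : NonZero m}} .{{_ : NonZero n}} →
              i ⁺ ℕ.* m ℕ.+ j ⁻ ℕ.* n ℕ.≤ j ⁺ ℕ.* n ℕ.+ i ⁻ ℕ.* m →
              i ℤ.* + m ℤ.≤ j ℤ.* + n
⁺⁻-cancel-≤ (+ a) (+ b) m n le = subst₂ ℤ._≤_ (ℤ.pos-* a m) (ℤ.pos-* b n)
  (ℤ.+≤+ (subst₂ ℕ._≤_ (ℕ.+-identityʳ _) (ℕ.+-identityʳ _) le))
⁺⁻-cancel-≤ (+ a) -[1+ b ] m (suc n) le =
  contradiction (ℕ.≤-trans (ℕ.m≤n+m _ (a ℕ.* m)) le) λ ()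
⁺⁻-cancel-≤ -[1+ a ] (+ b) (suc m) n le = subst (_ ℤ.≤_) (ℤ.pos-* b n) ℤ.-≤+
⁺⁻-cancel-≤ -[1+ a ] -[1+ b ] (suc m) (suc n) le = ℤ.-≤- (ℕ.s≤s⁻¹ le)

^-distribʳ-* : ∀ x y k → (x ℕ.* y) ℕ.^ k ≡ x ℕ.^ k ℕ.* y ℕ.^ k
^-distribʳ-* x y zero    = refl
^-distribʳ-* x y (suc k) = trans (cong (x ℕ.* y ℕ.*_) (^-distribʳ-* x y k))
  (solve 4 (λ x y a b → x :* y :* (a :* b) := x :* a :* (y :* b)) refl x y (x ℕ.^ k) (y ℕ.^ k))
  where open +-*-Solver

2^-≤-trans : ∀ {d r s} → 2^ r ≤ d → d ≤2^ s → r ℚ.≤ s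
2^-≤-trans {d} {r} {s} r≤d d≤s = ℚ.*≤* (⁺⁻-cancel-≤ (↥ r) (↥ s) (↧ₙ s) (↧ₙ r) (^-cancelʳ-≤ bound))
  where
  open ℕ.≤-Reasoning
  open +-*-Solver
  r⁺ = (↥ r) ⁺
  r⁻ = (↥ r) ⁻
  s⁺ = (↥ s) ⁺
  s⁻ = (↥ s) ⁻
  m = ↧ₙ r
  n = ↧ₙ s
  P = 2 ℕ.^ (s⁻ ℕ.* m)
  Q = 2 ℕ.^ (r⁻ ℕ.* n)

  ^-*-distrib : ∀ a b c e k → (a ℕ.^ b ℕ.* c ℕ.^ e) ℕ.^ k ≡ a ℕ.^ (b ℕ.* k) ℕ.* c ℕ.^ (e ℕ.* k)
  ^-*-distrib a b c e k = trans (^-distribʳ-* (a ℕ.^ b) (c ℕ.^ e) k)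
                                (cong₂ ℕ._*_ (ℕ.^-*-assoc a b k) (ℕ.^-*-assoc c e k))

  bound : 2 ℕ.^ (r⁺ ℕ.* n ℕ.+ s⁻ ℕ.* m) ℕ.≤ 2 ℕ.^ (s⁺ ℕ.* m ℕ.+ r⁻ ℕ.* n)
  bound = begin
    2 ℕ.^ (r⁺ ℕ.* n ℕ.+ s⁻ ℕ.* m)
      ≡⟨ ℕ.^-distribˡ-+-* 2 (r⁺ ℕ.* n) (s⁻ ℕ.* m) ⟩
    2 ℕ.^ (r⁺ ℕ.* n) ℕ.* P
      ≡⟨ cong (ℕ._* P) (sym (ℕ.^-*-assoc 2 r⁺ n)) ⟩
    (2 ℕ.^ r⁺) ℕ.^ n ℕ.* P
      ≤⟨ ℕ.*-monoˡ-≤ P (ℕ.^-monoˡ-≤ n r≤d) ⟩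
    (d ℕ.^ m ℕ.* 2 ℕ.^ r⁻) ℕ.^ n ℕ.* P
      ≡⟨ cong (ℕ._* P) (^-*-distrib d m 2 r⁻ n) ⟩
    d ℕ.^ (m ℕ.* n) ℕ.* Q ℕ.* P
      ≡⟨ solve 3 (λ x y z → x :* y :* z := x :* z :* y) refl
           (d ℕ.^ (m ℕ.* n)) Q P ⟩
    d ℕ.^ (m ℕ.* n) ℕ.* P ℕ.* Q
      ≡⟨ cong (λ k → d ℕ.^ k ℕ.* P ℕ.* Q) (ℕ.*-comm m n) ⟩
    d ℕ.^ (n ℕ.* m) ℕ.* P ℕ.* Q
      ≡⟨ cong (ℕ._* Q) (sym (^-*-distrib d n 2 s⁻ m)) ⟩
    (d ℕ.^ n ℕ.* 2 ℕ.^ s⁻) ℕ.^ m ℕ.* Q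
      ≤⟨ ℕ.*-monoˡ-≤ Q (ℕ.^-monoˡ-≤ m d≤s) ⟩
    (2 ℕ.^ s⁺) ℕ.^ m ℕ.* Q
      ≡⟨ cong (ℕ._* Q) (ℕ.^-*-assoc 2 s⁺ m) ⟩
    2 ℕ.^ (s⁺ ℕ.* m) ℕ.* Q
      ≡⟨ sym (ℕ.^-distribˡ-+-* 2 (s⁺ ℕ.* m) (r⁻ ℕ.* n)) ⟩
    2 ℕ.^ (s⁺ ℕ.* m ℕ.+ r⁻ ℕ.* n) ∎

-- The binary logarithm of d, i.e. the cut of those rationals r with 2^r < d.
log₂ : (d : ℕ) → .{{NonZero d}} → ℝ
log₂ d = cut (2^_≤ d) (d ≤2^_)
  (0ℚ , subst (1 ℕ.≤_) (sym (trans (ℕ.*-identityʳ _) (ℕ.*-identityʳ d))) (ℕ.>-nonZero⁻¹ d))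
  (ℕ→ℚ d , subst (ℕ._≤ 2 ℕ.^ d) (sym (trans (ℕ.*-identityʳ _) (ℕ.*-identityʳ d))) (n≤2^n d))
  (λ {r} {s} → 2^-≤-trans {d} {r} {s})
  (λ {p} p<q → Sum.map (λ p≤d → p , ℚ.≤-refl , p≤d) (λ d≤p → p , ℚ.<⇒≤ p<q , d≤p)
                       (ℕ.≤-total (2 ℕ.^ (↥ p) ⁺) (d ℕ.^ (↧ₙ p) ℕ.* 2 ℕ.^ (↥ p) ⁻)))

------------------------------------------------------------------------
-- Graphs and intersection representations

record FiniteSimpleGraph : Set₁ where
  field
    Vertex      : Set
    order       : ℕ
    enumeration : Vertex ↔ Fin order
    Adj         : Vertex → Vertex → Set
    adj?        : Decidable Adj
    adj-sym     : Symmetric Adj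
    adj-irrefl  : ∀ {v} → ¬ Adj v v

open FiniteSimpleGraph public

-- S u ≬ S v says that S u and S v have a common element.
IsIntersectionRepresentation :
  ∀ {a ℓ} {A : Set a} (G : FiniteSimpleGraph) → (Vertex G → Pred A ℓ) → Set (a ⊔ ℓ)
IsIntersectionRepresentation G S = ∀ u v → u ≢ v → Adj G u v ⇔ (S u ≬ S v)

record ClosedInterval : Set₁ where
  field
    lo hi : ℝ
    lo≤hi : lo ≤ʳ hi

open ClosedInterval public

Box : ℕ → Set₁
Box k = Fin k → ClosedInterval

⟦_⟧ : ∀ {k} → Box k → Pred (Fin k → ℝ) 0ℓ
⟦ R ⟧ x = ∀ i → lo (R i) ≤ʳ x i × x i ≤ʳ hi (R i)

BoxRepresentable : FiniteSimpleGraph → ℕ → Set₁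
BoxRepresentable G k =
  Σ[ B ∈ (Vertex G → Box k) ] IsIntersectionRepresentation G (λ v → ⟦ B v ⟧)

IsBoxicity : FiniteSimpleGraph → ℕ → Set₁
IsBoxicity G k = BoxRepresentable G k × (∀ j → BoxRepresentable G j → k ℕ.≤ j)

------------------------------------------------------------------------
-- Every finite simple graph has a boxicity. To find the least k it is shown
-- that representability by k-dimensional boxes is decidable, since the
-- endpoints may be taken to be natural numbers bounded in terms of the order;
-- then k = order is always enough.

fromℕ : ℕ → ℝ
fromℕ n = fromℚ (ℕ→ℚ n)

ℕ→ℚ-mono-≤ : ∀ {m n} → m ℕ.≤ n → ℕ→ℚ m ℚ.≤ ℕ→ℚ n
ℕ→ℚ-mono-≤ m≤n = ℚ.*≤* (ℤ.*-monoʳ-≤-nonNeg (+ 1) (ℤ.+≤+ m≤n))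

ℕ→ℚ-cancel-≤ : ∀ {m n} → ℕ→ℚ m ℚ.≤ ℕ→ℚ n → m ℕ.≤ n
ℕ→ℚ-cancel-≤ {m} {n} (ℚ.*≤* le) = ℤ.drop‿+≤+ (ℤ.*-cancelʳ-≤-pos (+ m) (+ n) (+ 1) le)

fromℕ-mono-≤ : ∀ {m n} → m ℕ.≤ n → fromℕ m ≤ʳ fromℕ n
fromℕ-mono-≤ m≤n q (r , q<r , r≤m) = r , q<r , ℚ.≤-trans r≤m (ℕ→ℚ-mono-≤ m≤n)

fromℕ-cancel-≤ : ∀ {m n} → fromℕ m ≤ʳ fromℕ n → m ℕ.≤ n
fromℕ-cancel-≤ {m} {n} le = ℕ.≮⇒≥ λ n<m →
  let r , q<r , r≤n = le (ℕ→ℚ n) (ℕ→ℚ m , ℚ.≰⇒> (ℕ.<⇒≱ n<m ∘ ℕ→ℚ-cancel-≤) , ℚ.≤-refl)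
  in ℚ.<-irrefl refl (ℚ.<-≤-trans q<r r≤n)

Searchable : Set → Set₁
Searchable A = ∀ {P : Pred A 0ℓ} → (∀ x → Dec (P x)) → Dec (∃ P)

search-Fin : ∀ n → Searchable (Fin n)
search-Fin n = any?

search-× : ∀ {A B} → Searchable A → Searchable B → Searchable (A × B)
search-× sA sB P? = map′ (λ (a , b , p) → (a , b) , p) (λ ((a , b) , p) → a , b , p)
  (sA λ a → sB λ b → P? (a , b))

search-Vec : ∀ {A} → Searchable A → ∀ n → Searchable (Vec A n)
search-Vec sA zero    P? = map′ ([] ,_) (λ { ([] , p) → p }) (P? [])
search-Vec sA (suc n) P? = map′ (λ (x , xs , p) → x ∷ xs , p) (λ { (x ∷ xs , p) → x , xs , p })
  (sA λ x → search-Vec sA n λ xs → P? (x ∷ xs))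

least : ∀ {ℓ} {P : Pred ℕ ℓ} → (∀ n → Dec (P n)) →
        ∀ n → P n → ∃[ m ] P m × (∀ j → P j → m ℕ.≤ j)
least {P = P} P? n Pn with P? 0
... | yes P0 = 0 , P0 , λ _ _ → z≤n
least P? zero    Pn | no ¬P0 = contradiction Pn ¬P0
least {P = P} P? (suc n) Pn | no ¬P0 =
  let m , Pm , min = least (P? ∘ suc) n Pn
  in suc m , Pm , λ { zero    P0 → contradiction P0 ¬P0
                    ; (suc j) Pj → s≤s (min j Pj) }

module _ {n} {P : Pred (Fin n) 0ℓ} (P? : ∀ i → Dec (P i)) where

  toSubset : Subset n
  toSubset = tabulate (does ∘ P?)

  ∈-toSubset⁺ : ∀ {i} → P i → i ∈ˢ toSubset
  ∈-toSubset⁺ {i} p = lookup⇒[]= i toSubset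
    (trans (lookup∘tabulate (does ∘ P?) i) (dec-true (P? i) p))

  ∈-toSubset⁻ : ∀ {i} → i ∈ˢ toSubset → P i
  ∈-toSubset⁻ {i} i∈ with P? i in eq
  ... | yes p = p
  ... | no ¬p = contradiction
    (trans (sym (cong does eq)) (trans (sym (lookup∘tabulate (does ∘ P?) i)) ([]=⇒lookup i∈)))
    λ ()

module _ (G : FiniteSimpleGraph) where

  private
    N M : ℕ
    N = order G
    M = 2 ℕ.+ N

    open Inverse (enumeration G) using (to; from; strictlyInverseˡ; strictlyInverseʳ)

    to-injective : ∀ {u v} → to u ≡ to v → u ≡ v
    to-injective {u} {v} eq =
      trans (sym (strictlyInverseʳ u)) (trans (cong from eq) (strictlyInverseʳ v))

    from-injective : ∀ {i j} → from i ≡ from j → i ≡ j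
    from-injective {i} {j} eq =
      trans (sym (strictlyInverseˡ i)) (trans (cong to eq) (strictlyInverseˡ j))

    Table : ℕ → Set
    Table k = Vec (Vec (Fin M × Fin M) N) k

    left right : ∀ {k} → Table k → Fin k → Fin N → ℕ
    left  T i u = toℕ (proj₁ (lookup (lookup T i) u))
    right T i u = toℕ (proj₂ (lookup (lookup T i) u))

    Overlap : ∀ {k} → Table k → Fin N → Fin N → Set
    Overlap T u v = ∀ i → left T i u ℕ.≤ right T i v × left T i v ℕ.≤ right T i u

    Realises : ∀ {k} → Pred (Table k) 0ℓ
    Realises T = (∀ i u → left T i u ℕ.≤ right T i u) ×
                 (∀ u v → u ≢ v → (Adj G (from u) (from v) → Overlap T u v) ×
                                  (Overlap T u v → Adj G (from u) (from v)))

    realises? : ∀ {k} (T : Table k) → Dec (Realises T)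
    realises? T =
      (all? λ i → all? λ u → left T i u ℕ.≤? right T i u) ×-dec
      (all? λ u → all? λ v → ¬? (u Fin.≟ v) →-dec
        ((adj? G _ _ →-dec overlap? u v) ×-dec (overlap? u v →-dec adj? G _ _)))
      where
      overlap? : ∀ u v → Dec (Overlap T u v)
      overlap? u v = all? λ i → (left T i u ℕ.≤? right T i v) ×-dec (left T i v ℕ.≤? right T i u)

    table? : ∀ k → Dec (∃ (Realises {k}))
    table? k = search-Vec (search-Vec (search-× (search-Fin M) (search-Fin M)) N) k realises?

    table⇒boxes : ∀ {k} → ∃ (Realises {k}) → BoxRepresentable G k
    table⇒boxes {k} (T , l≤r , realises) = B , λ u v u≢v → mk⇔ (meet u≢v) (adjacent u≢v)
      where
      B : Vertex G → Box k
      B v i = record { lo = fromℕ (left T i (to v)) ; hi = fromℕ (right T i (to v))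
                     ; lo≤hi = fromℕ-mono-≤ (l≤r i (to v)) }

      Adj′⇒Adj : ∀ {u v} → Adj G (from (to u)) (from (to v)) → Adj G u v
      Adj′⇒Adj {u} {v} = subst₂ (Adj G) (strictlyInverseʳ u) (strictlyInverseʳ v)

      Adj⇒Adj′ : ∀ {u v} → Adj G u v → Adj G (from (to u)) (from (to v))
      Adj⇒Adj′ {u} {v} = subst₂ (Adj G) (sym (strictlyInverseʳ u)) (sym (strictlyInverseʳ v))

      meet : ∀ {u v} → u ≢ v → Adj G u v → ⟦ B u ⟧ ≬ ⟦ B v ⟧
      meet {u} {v} u≢v uv = (λ i → fromℕ (left T i (to u) ℕ.⊔ left T i (to v))) ,
        (λ i → fromℕ-mono-≤ (ℕ.m≤m⊔n (left T i (to u)) _) ,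
               fromℕ-mono-≤ (ℕ.⊔-lub (l≤r i (to u)) (proj₂ (overlaps i)))) ,
        (λ i → fromℕ-mono-≤ (ℕ.m≤n⊔m (left T i (to u)) _) ,
               fromℕ-mono-≤ (ℕ.⊔-lub (proj₁ (overlaps i)) (l≤r i (to v))))
        where
        overlaps : Overlap T (to u) (to v)
        overlaps = proj₁ (realises (to u) (to v) (u≢v ∘ to-injective)) (Adj⇒Adj′ uv)

      adjacent : ∀ {u v} → u ≢ v → ⟦ B u ⟧ ≬ ⟦ B v ⟧ → Adj G u v
      adjacent {u} {v} u≢v (x , x∈u , x∈v) = Adj′⇒Adj
        (proj₂ (realises (to u) (to v) (u≢v ∘ to-injective)) λ i →
          fromℕ-cancel-≤ {left T i (to u)} {right T i (to v)}
            (≤ʳ-trans (lo (B u i)) (x i) (hi (B v i)) (proj₁ (x∈u i)) (proj₂ (x∈v i))) ,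
          fromℕ-cancel-≤ {left T i (to v)} {right T i (to u)}
            (≤ʳ-trans (lo (B v i)) (x i) (hi (B u i)) (proj₁ (x∈v i)) (proj₂ (x∈u i))))

    boxes⇒table : ∀ {k} → BoxRepresentable G k → ∃ (Realises {k})
    boxes⇒table {k} (B , rep) = decidable-stable (table? k) (¬¬-map build ¬¬comparisons)
      where
      open RawMonad (¬¬-Monad {0ℓ}) using (rawApplicative; _<$>_)

      ¬¬-map : ∀ {A B : Set} → (A → B) → ¬ ¬ A → ¬ ¬ B
      ¬¬-map f = f <$>_

      a b : Fin k → Fin N → ℝ
      a i u = lo (B (from u) i)
      b i u = hi (B (from u) i)

      Comparisons : Set
      Comparisons = ∀ i u v → Dec (a i u ≤ʳ a i v) × Dec (a i u ≤ʳ b i v)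

      ¬¬comparisons : ¬ ¬ Comparisons
      ¬¬comparisons = sequence rawApplicative λ i → sequence rawApplicative λ u →
        sequence rawApplicative λ v ¬both →
          ¬¬-excluded-middle λ d → ¬¬-excluded-middle λ e → ¬both (d , e)

      build : Comparisons → ∃ (Realises {k})
      build cmp = T , l≤r , λ u v u≢v → overlaps u≢v , adjacent u≢v
        where
        before? : ∀ i u w → Dec (¬ (a i u ≤ʳ a i w))
        before? i u w = ¬? (proj₁ (cmp i u w))

        upto? : ∀ i v w → Dec (a i w ≤ʳ b i v)
        upto? i v w = proj₂ (cmp i w v)

        before upto : Fin k → Fin N → Subset N
        before i u = toSubset (before? i u)
        upto   i v = toSubset (upto? i v)

        rank-mono : ∀ i u v → a i u ≤ʳ b i v → ∣ before i u ∣ ℕ.< ∣ upto i v ∣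
        rank-mono i u v au≤bv = p⊂q⇒∣p∣<∣q∣
          ( (λ {w} w∈ → ∈-toSubset⁺ (upto? i v) {w} λ q →
               au≤bv q ∘ ≰ʳ⇒≥ʳ (a i u) (a i w) (∈-toSubset⁻ (before? i u) w∈) q)
          , u , ∈-toSubset⁺ (upto? i v) {u} au≤bv
          , λ u∈ → ∈-toSubset⁻ (before? i u) u∈ (≤ʳ-refl (a i u)) )

        rank-cancel : ∀ i u v → ∣ before i u ∣ ℕ.< ∣ upto i v ∣ → a i u ≤ʳ b i v
        rank-cancel i u v lt with proj₂ (cmp i u v)
        ... | yes au≤bv = au≤bv
        ... | no  au≰bv = contradiction
          (p⊆q⇒∣p∣≤∣q∣ λ {w} w∈ → ∈-toSubset⁺ (before? i u) {w} λ au≤aw →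
             au≰bv λ q → ∈-toSubset⁻ (upto? i v) w∈ q ∘ au≤aw q)
          (ℕ.<⇒≱ lt)

        cell : Fin k → Fin N → Fin M × Fin M
        cell i u = fromℕ< (s≤s (s≤s (∣p∣≤n (before i u)))) ,
                   fromℕ< (s≤s (ℕ.m≤n⇒m≤1+n (∣p∣≤n (upto i u))))

        T : Table k
        T = tabulate λ i → tabulate (cell i)

        T-lookup : ∀ i u → lookup (lookup T i) u ≡ cell i u
        T-lookup i u = trans (cong (λ row → lookup row u) (lookup∘tabulate (λ i → tabulate (cell i)) i))
                               (lookup∘tabulate (cell i) u)

        left≡ : ∀ i u → left T i u ≡ suc ∣ before i u ∣
        left≡ i u = trans (cong (toℕ ∘ proj₁) (T-lookup i u))
                          (toℕ-fromℕ< (s≤s (s≤s (∣p∣≤n (before i u)))))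

        right≡ : ∀ i u → right T i u ≡ ∣ upto i u ∣
        right≡ i u = trans (cong (toℕ ∘ proj₂) (T-lookup i u))
                           (toℕ-fromℕ< (s≤s (ℕ.m≤n⇒m≤1+n (∣p∣≤n (upto i u)))))

        T-mono : ∀ i u v → a i u ≤ʳ b i v → left T i u ℕ.≤ right T i v
        T-mono i u v le = subst₂ ℕ._≤_ (sym (left≡ i u)) (sym (right≡ i v)) (rank-mono i u v le)

        T-cancel : ∀ i u v → left T i u ℕ.≤ right T i v → a i u ≤ʳ b i v
        T-cancel i u v le = rank-cancel i u v (subst₂ ℕ._≤_ (left≡ i u) (right≡ i v) le)

        l≤r : ∀ i u → left T i u ℕ.≤ right T i u
        l≤r i u = T-mono i u u (lo≤hi (B (from u) i))

        overlaps : ∀ {u v} → u ≢ v → Adj G (from u) (from v) → Overlap T u v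
        overlaps {u} {v} u≢v uv i =
          let x , x∈u , x∈v = Equivalence.to (rep _ _ (u≢v ∘ from-injective)) uv
          in T-mono i u v (≤ʳ-trans (a i u) (x i) (b i v) (proj₁ (x∈u i)) (proj₂ (x∈v i))) ,
             T-mono i v u (≤ʳ-trans (a i v) (x i) (b i u) (proj₁ (x∈v i)) (proj₂ (x∈u i)))

        adjacent : ∀ {u v} → u ≢ v → Overlap T u v → Adj G (from u) (from v)
        adjacent {u} {v} u≢v o = Equivalence.from (rep _ _ (u≢v ∘ from-injective))
          ((λ i → proj₁ (common i)) , (λ i → proj₁ (proj₂ (common i))) , (λ i → proj₂ (proj₂ (common i))))
          where
          common : ∀ i → ∃[ x ] (a i u ≤ʳ x × x ≤ʳ b i u) × (a i v ≤ʳ x × x ≤ʳ b i v)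
          common i with proj₁ (cmp i u v)
          ... | yes au≤av = a i v , (au≤av , T-cancel i v u (proj₂ (o i))) ,
                                    (≤ʳ-refl (a i v) , lo≤hi (B (from v) i))
          ... | no  au≰av = a i u , (≤ʳ-refl (a i u) , lo≤hi (B (from u) i)) ,
                                    (≰ʳ⇒≥ʳ (a i u) (a i v) au≰av , T-cancel i u v (proj₁ (o i)))

    -- In coordinate i, vertex i is [0,0], its neighbours are [0,1] and the other
    -- vertices are [1,1].
    entry : Fin N → Fin N → Fin M × Fin M
    entry i u with i Fin.≟ u | adj? G (from i) (from u)
    ... | yes _ | _     = zero , zero
    ... | no _  | yes _ = zero , suc zero
    ... | no _  | no _  = suc zero , suc zero

    Meets : Fin M × Fin M → Fin M × Fin M → Set
    Meets (l , r) (l′ , r′) = toℕ l ℕ.≤ toℕ r′ × toℕ l′ ℕ.≤ toℕ r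

    entry-valid : ∀ i u → toℕ (proj₁ (entry i u)) ℕ.≤ toℕ (proj₂ (entry i u))
    entry-valid i u with i Fin.≟ u | adj? G (from i) (from u)
    ... | yes _ | _     = z≤n
    ... | no _  | yes _ = z≤n
    ... | no _  | no _  = s≤s z≤n

    entry-meets : ∀ i {u v} → u ≢ v → Adj G (from u) (from v) → Meets (entry i u) (entry i v)
    entry-meets i {u} {v} u≢v uv
      with i Fin.≟ u | adj? G (from i) (from u) | i Fin.≟ v | adj? G (from i) (from v)
    ... | yes refl | _     | yes refl | _     = contradiction refl u≢v
    ... | yes refl | _     | no _     | yes _ = z≤n , z≤n
    ... | yes refl | _     | no _     | no ¬a = contradiction uv ¬a
    ... | no _     | yes _ | yes refl | _     = z≤n , z≤n
    ... | no _     | no ¬a | yes refl | _     = contradiction (adj-sym G uv) ¬a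
    ... | no _     | yes _ | no _     | yes _ = z≤n , z≤n
    ... | no _     | yes _ | no _     | no _  = z≤n , s≤s z≤n
    ... | no _     | no _  | no _     | yes _ = s≤s z≤n , z≤n
    ... | no _     | no _  | no _     | no _  = s≤s z≤n , s≤s z≤n

    entry-adjacent : ∀ {u v} → u ≢ v → Meets (entry u u) (entry u v) → Adj G (from u) (from v)
    entry-adjacent {u} {v} u≢v meets
      with u Fin.≟ u | u Fin.≟ v | adj? G (from u) (from v)
    ... | no u≢u | _       | _     = contradiction refl u≢u
    ... | yes _  | yes u≡v | _     = contradiction u≡v u≢v
    ... | yes _  | no _    | yes a = a
    ... | yes _  | no _    | no _  = contradiction (proj₂ meets) λ ()

    robertsTable : Table N
    robertsTable = tabulate λ i → tabulate (entry i)

    robertsTable-realises : Realises robertsTable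
    robertsTable-realises =
      (λ i u → subst (λ e → toℕ (proj₁ e) ℕ.≤ toℕ (proj₂ e)) (sym (lookup-entry i u))
                     (entry-valid i u)) ,
      λ u v u≢v →
        (λ uv i → subst₂ Meets (sym (lookup-entry i u)) (sym (lookup-entry i v))
                         (entry-meets i u≢v uv)) ,
        (λ meets → entry-adjacent u≢v
           (subst₂ Meets (lookup-entry u u) (lookup-entry u v) (meets u)))
      where
      lookup-entry : ∀ i u → lookup (lookup robertsTable i) u ≡ entry i u
      lookup-entry i u = trans (cong (λ row → lookup row u) (lookup∘tabulate _ i))
                               (lookup∘tabulate (entry i) u)

  abstract
    boxicity : ∃ (IsBoxicity G)
    boxicity = least (λ k → map′ table⇒boxes boxes⇒table (table? k)) N 
               (table⇒boxes (robertsTable , robertsTable-realises))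

  box : ℕ
  box = proj₁ boxicity

  box-isBoxicity : IsBoxicity G box
  box-isBoxicity = proj₂ boxicity

------------------------------------------------------------------------
-- Hypercubes

hypercube : ℕ → FiniteSimpleGraph
hypercube d = record
  { Vertex      = Vec Bool d
  ; order       = 2 ℕ.^ d
  ; enumeration = strings d
  ; Adj         = λ u v → ∃! _≡_ (DifferAt u v)
  ; adj?        = λ u v → map′ (λ (i , i≢ , uniq) → i , i≢ , λ {j} → uniq j)
                               (λ (i , i≢ , uniq) → i , i≢ , λ j → uniq {j})
                    (any? λ i → differAt? u v i ×-dec all? λ j → differAt? u v j →-dec i Fin.≟ j)
  ; adj-sym     = λ (i , i≢ , uniq) → i , i≢ ∘ sym , λ j≢ → uniq (j≢ ∘ sym)
  ; adj-irrefl  = λ (i , i≢ , uniq) → i≢ refl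
  }
  where
  DifferAt : Vec Bool d → Vec Bool d → Fin d → Set
  DifferAt u v i = lookup u i ≢ lookup v i

  differAt? : ∀ u v i → Dec (DifferAt u v i)
  differAt? u v i = ¬? (lookup u i Bool.≟ lookup v i)

  uncons-↔ : ∀ {n} → Vec Bool (suc n) ↔ (Bool × Vec Bool n)
  uncons-↔ = mk↔ₛ′ (λ { (x ∷ xs) → x , xs }) (λ (x , xs) → x ∷ xs)
                   (λ _ → refl) (λ { (_ ∷ _) → refl })

  strings : ∀ n → Vec Bool n ↔ Fin (2 ℕ.^ n)
  strings zero    = mk↔ₛ′ (λ _ → zero) (λ _ → []) (λ { zero → refl }) (λ { [] → refl })
  strings (suc n) = ↔-trans uncons-↔ (↔-trans (↔-sym 2↔Bool ×-↔ strings n) (↔-sym *↔×))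

{-# OPTIONS --safe #-}

-- A vertex u of the cube is read as a 0/1 vector. A matrix with entries ±1 gives one
-- interval graph per row r, with intervals [r·u, r·u + 1]; these contain all edges of
-- the cube. It suffices that, for w = u - v in {-1,0,1}^d, all |r·w| ≤ 1 only if w has
-- at most one nonzero entry. Split the positions into 2^k blocks, each a set of columns
-- of the Cantor–Mills matrix: about k 2^(k-1) columns, 2^k rows, entries 0, ±1, and no
-- nonzero vector of {-1,0,1}^n in the kernel. Replacing the zeros once by 1 and once by
-- -1 gives a ±1 matrix D of 2^(k+1) rows with the same property. The rows of H ⊗ D, H the
-- Sylvester–Hadamard matrix, then force w into a single block (for each row of D only one
-- block can have a nonzero value, and parity makes it the same block for all rows).
-- Applying a larger Sylvester–Hadamard matrix to the sum of the blocks in the same way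
-- leaves a single position. In all there are 3·4^k rows for about k 4^k / 2 positions.
module Submission where

open import Defs
open import Data.Bool.Base using (Bool; true; false; if_then_else_)
import Data.Bool.Properties as Bool
open import Data.Fin.Base using (Fin; zero; suc; punchIn)
open import Data.Fin.Properties using (+↔⊎; *↔×; 1↔⊤; any?; inject≤-injective; punchInᵢ≢i)
open import Data.Integer.Base using (ℤ; +_; -[1+_]; 0ℤ; 1ℤ; -1ℤ; _+_; _*_; -_; _-_; ∣_∣)
import Data.Integer.Base as ℤ
import Data.Integer.Properties as ℤ
open import Data.Integer.Solver using (module +-*-Solver)
open import Data.Maybe.Base using (Maybe; just; nothing; maybe′; map)
open import Data.Nat.Base using (ℕ; zero; suc; z≤n; s≤s; _≤_; NonZero; >-nonZero)
import Data.Nat.Base as ℕ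
import Data.Nat.Properties as ℕ
import Data.Nat.Solver as ℕSolver
open import Data.Nat.Coprimality using (1-coprimeTo) renaming (sym to coprime-sym)
open import Data.Nat.Properties using (<⇒≤)
open import Data.Product.Base using (Σ-syntax; ∃-syntax; _×_; _,_; proj₁; proj₂)
open import Data.Rational.Base as ℚ using (ℚ; mkℚ)
import Data.Rational.Properties as ℚ
import Data.Rational.Unnormalised.Base as ℚᵘ
import Data.Rational.Unnormalised.Properties as ℚᵘ
open import Data.Sign.Base using (Sign; opposite)
import Data.Sign.Base as Sign
open import Data.Sum.Base using (_⊎_; inj₁; inj₂)
import Data.Sum.Properties as Sum
open import Data.Sum.Function.Propositional using (_⊎-↔_)
open import Data.Product.Function.NonDependent.Propositional using (_×-↔_)
open import Data.Unit.Base using (⊤; tt)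
import Data.Unit.Properties as Unit
open import Data.Vec.Base using (Vec; []; _∷_; lookup)
import Data.Vec.Properties as Vec
open import Function.Base using (_∘_; const)
open import Function.Bundles using (_↔_; _↣_; _⇔_; mk⇔; mk↣; Equivalence; Injection; Inverse)
open import Function.Construct.Composition using (_↣-∘_)
open import Function.Properties.Inverse using (↔-refl; ↔-sym; ↔-trans; ↔⇒↣)
open import Function.Definitions using (Injective)
open import Relation.Binary.Definitions using (DecidableEquality)
open import Relation.Binary.PropositionalEquality
open import Relation.Unary using (_≬_)
open import Relation.Nullary using (¬_; yes; no; does; contradiction)
open import Relation.Nullary.Decidable using (_×-dec_; ¬?; dec-true; dec-false; decidable-stable)
open import Algebra.Properties.CommutativeMonoid.Sum ℤ.+-0-commutativeMonoid
  using (sum; sum-remove; sum-cong-≗; ∑-distrib-+; sum-replicate-zero)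
open import Algebra.Properties.AbelianGroup ℤ.+-0-abelianGroup using (identityˡ-unique; inverseʳ-unique)
open +-*-Solver using (solve; _:=_; _:+_; _:*_; :-_; _:-_; con)
open ℕSolver.+-*-Solver using ()
  renaming (solve to solveℕ; _:=_ to _≔_; _:+_ to _+ℕ_; _:*_ to _*ℕ_; con to conℕ)

-- Integers of absolute value at most one

data Small : ℤ → Set where
  small₋ : Small -1ℤ
  small₀ : Small 0ℤ
  small₊ : Small 1ℤ

Small⇒∣i∣≤1 : ∀ {i} → Small i → ∣ i ∣ ≤ 1
Small⇒∣i∣≤1 small₋ = s≤s z≤n
Small⇒∣i∣≤1 small₀ = z≤n
Small⇒∣i∣≤1 small₊ = s≤s z≤n

∣i+i∣≤2⇒Small : ∀ i → ∣ i + i ∣ ≤ 2 → Small i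
∣i+i∣≤2⇒Small (+ 0)             _ = small₀
∣i+i∣≤2⇒Small (+ 1)             _ = small₊
∣i+i∣≤2⇒Small (+ suc (suc n))   (s≤s (s≤s le)) =
  contradiction (subst (ℕ._≤ 0) (ℕ.+-suc n (suc n)) le) λ ()
∣i+i∣≤2⇒Small -[1+ 0 ]          _ = small₋
∣i+i∣≤2⇒Small -[1+ suc n ]      (s≤s (s≤s ()))

half-small : ∀ {i s t} → Small s → Small t → i + i ≡ s + t → Small i
half-small {i} {s} {t} small-s small-t eq = ∣i+i∣≤2⇒Small i
  (ℕ.≤-trans (ℕ.≤-reflexive (cong ∣_∣ eq))
    (ℕ.≤-trans (ℤ.∣i+j∣≤∣i∣+∣j∣ s t) (ℕ.+-mono-≤ (Small⇒∣i∣≤1 small-s) (Small⇒∣i∣≤1 small-t))))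

-- The sum and the difference of `i + j` and `i - j` are `2i` and `2j`, so `i` and `j` are small
-- themselves; if both were nonzero, one of `i + j` and `i - j` would be 2 or -2.
small-± : ∀ i j → Small (i + j) → Small (i - j) →
          (i ≡ 0ℤ × Small j) ⊎ (j ≡ 0ℤ × Small i)
small-± i j i+j i-j = cases
  (half-small i+j i-j (solve 2 (λ i j → i :+ i := (i :+ j) :+ (i :- j)) refl i j))
  (half-small i+j (small-neg i-j) (solve 2 (λ i j → j :+ j := (i :+ j) :+ (:- (i :- j))) refl i j))
  i+j i-j
  where
  small-neg : ∀ {i} → Small i → Small (- i)
  small-neg small₋ = small₊
  small-neg small₀ = small₀
  small-neg small₊ = small₋

  cases : ∀ {i j} → Small i → Small j → Small (i + j) → Small (i - j) →
          (i ≡ 0ℤ × Small j) ⊎ (j ≡ 0ℤ × Small i)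
  cases small₀ sj     _  _  = inj₁ (refl , sj)
  cases si     small₀ _  _  = inj₂ (refl , si)
  cases small₋ small₋ () _
  cases small₋ small₊ _  ()
  cases small₊ small₋ _  ()
  cases small₊ small₊ () _

zero-± : ∀ i j → i + j ≡ 0ℤ → i - j ≡ 0ℤ → i ≡ 0ℤ × j ≡ 0ℤ
zero-± i j i+j≡0 i-j≡0
  with small-± i j (subst Small (sym i+j≡0) small₀) (subst Small (sym i-j≡0) small₀)
... | inj₁ (refl , _) = refl , trans (sym (ℤ.+-identityˡ j)) i+j≡0
... | inj₂ (refl , _) = trans (sym (ℤ.+-identityʳ i)) i+j≡0 , refl

small-even⇒0 : ∀ i → Small (i + i) → i + i ≡ 0ℤ
small-even⇒0 i small with i | ∣i+i∣≤2⇒Small i (ℕ.m≤n⇒m≤1+n (Small⇒∣i∣≤1 small)) | small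
... | _ | small₋ | ()
... | _ | small₀ | _  = refl
... | _ | small₊ | ()

-- The right-hand side says that the unit intervals starting at `i` and `j` meet.
small-difference : ∀ {i j} → Small (i - j) ⇔ (i ℤ.≤ 1ℤ + j × j ℤ.≤ 1ℤ + i)
small-difference {i} {j} = mk⇔ to from
  where
  to : Small (i - j) → i ℤ.≤ 1ℤ + j × j ℤ.≤ 1ℤ + i
  to small = shift (i - j) j i (bound small) (solve 2 (λ i j → (i :- j) :+ j := i) refl i j) ,
             shift (- (i - j)) i j (bound′ small) (solve 2 (λ i j → (:- (i :- j)) :+ i := j) refl i j)
    where
    bound : ∀ {z} → Small z → z ℤ.≤ 1ℤ
    bound small₋ = ℤ.-≤+
    bound small₀ = ℤ.+≤+ z≤n
    bound small₊ = ℤ.≤-refl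

    bound′ : ∀ {z} → Small z → - z ℤ.≤ 1ℤ
    bound′ small₋ = ℤ.≤-refl
    bound′ small₀ = ℤ.+≤+ z≤n
    bound′ small₊ = ℤ.-≤+

    shift : ∀ z y x → z ℤ.≤ 1ℤ → z + y ≡ x → x ℤ.≤ 1ℤ + y
    shift z y x z≤1 refl = ℤ.+-monoˡ-≤ y z≤1

  from : i ℤ.≤ 1ℤ + j × j ℤ.≤ 1ℤ + i → Small (i - j)
  from (i≤ , j≤) = bounded (i - j)
    (subst (i - j ℤ.≤_) (solve 1 (λ j → con 1ℤ :+ j :- j := con 1ℤ) refl j) (ℤ.+-monoˡ-≤ (- j) i≤))
    (subst₂ ℤ._≤_ (solve 2 (λ i j → j :- i := :- (i :- j)) refl i j)
                  (solve 1 (λ i → con 1ℤ :+ i :- i := con 1ℤ) refl i) (ℤ.+-monoˡ-≤ (- i) j≤))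
    where
    bounded : ∀ z → z ℤ.≤ 1ℤ → - z ℤ.≤ 1ℤ → Small z
    bounded (+ 0)            _ _ = small₀
    bounded (+ 1)            _ _ = small₊
    bounded (+ suc (suc n))  (ℤ.+≤+ (s≤s ())) _
    bounded -[1+ 0 ]         _ _ = small₋
    bounded -[1+ suc n ]     _ (ℤ.+≤+ (s≤s ()))

-- Congruence modulo 2

infix 4 _≡₂_

record _≡₂_ (i j : ℤ) : Set where
  constructor by
  field
    half : ℤ
    eq   : i ≡ j + (half + half)

even⊎odd : ∀ i → i ≡₂ 0ℤ ⊎ i ≡₂ 1ℤ
even⊎odd (+ zero)  = inj₁ (by 0ℤ refl)
even⊎odd (+ suc n) with even⊎odd (+ n)
... | inj₁ (by q eq) = inj₂ (by q (trans (cong (_+_ 1ℤ) eq)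
  (solve 1 (λ q → con 1ℤ :+ (con 0ℤ :+ (q :+ q)) := con 1ℤ :+ (q :+ q)) refl q)))
... | inj₂ (by q eq) = inj₁ (by (1ℤ + q) (trans (cong (_+_ 1ℤ) eq)
  (solve 1 (λ q → con 1ℤ :+ (con 1ℤ :+ (q :+ q)) := con 0ℤ :+ ((con 1ℤ :+ q) :+ (con 1ℤ :+ q))) refl q)))
even⊎odd -[1+ zero ]  = inj₂ (by -1ℤ refl)
even⊎odd -[1+ suc n ] with even⊎odd -[1+ n ]
... | inj₁ (by q eq) = inj₂ (by (-1ℤ + q) (trans (cong (_+_ -1ℤ) eq)
  (solve 1 (λ q → con -1ℤ :+ (con 0ℤ :+ (q :+ q)) := con 1ℤ :+ ((con -1ℤ :+ q) :+ (con -1ℤ :+ q))) refl q)))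
... | inj₂ (by q eq) = inj₁ (by q (trans (cong (_+_ -1ℤ) eq)
  (solve 1 (λ q → con -1ℤ :+ (con 1ℤ :+ (q :+ q)) := con 0ℤ :+ (q :+ q)) refl q)))

≡₂-trans : ∀ {i j k} → i ≡₂ j → j ≡₂ k → i ≡₂ k
≡₂-trans {k = k} (by p refl) (by q refl) = by (p + q)
  (solve 3 (λ k p q → k :+ (q :+ q) :+ (p :+ p) := k :+ ((p :+ q) :+ (p :+ q))) refl k p q)

small-even : ∀ {i} → Small i → i ≡₂ 0ℤ → i ≡ 0ℤ
small-even small (by q refl) = trans (ℤ.+-identityˡ _)
  (small-even⇒0 q (subst Small (ℤ.+-identityˡ _) small))

odd≢0 : ∀ {i} → i ≡₂ 1ℤ → i ≢ 0ℤ
odd≢0 {i} (by q eq) i≡0 = contradiction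
  (small-even⇒0 q (subst Small (sym q+q≡-1) small₋)) λ q+q≡0 → contradiction (trans (sym q+q≡-1) q+q≡0) λ ()
  where
  q+q≡-1 : q + q ≡ -1ℤ
  q+q≡-1 = trans (solve 1 (λ q → q :+ q := con -1ℤ :+ (con 1ℤ :+ (q :+ q))) refl q)
                 (cong (_+_ -1ℤ) (trans (sym eq) i≡0))

-- Additive functionals on integer-valued functions

-- `E h` stands for the scalar product of a fixed integer vector with a row `h`. With functionals in
-- place of sums, passing to a subset of the coordinates is a composition.
record IsAdditive {X : Set} (E : (X → ℤ) → ℤ) : Set where
  field
    ext    : ∀ {f g} → f ≗ g → E f ≡ E g
    +-homo : ∀ f g → E (λ x → f x + g x) ≡ E f + E g

  0-homo : E (const 0ℤ) ≡ 0ℤ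
  0-homo = identityˡ-unique _ _ (sym (+-homo (const 0ℤ) (const 0ℤ)))

  neg-homo : ∀ f → E (λ x → - f x) ≡ - E f
  neg-homo f = inverseʳ-unique _ _
    (trans (sym (+-homo f (λ x → - f x))) (trans (ext λ x → ℤ.+-inverseʳ (f x)) 0-homo))

open IsAdditive

∘-additive : ∀ {X Y : Set} {E : (X → ℤ) → ℤ} {L : X → (Y → ℤ) → ℤ} →
             IsAdditive E → (∀ x → IsAdditive (L x)) → IsAdditive (λ h → E (λ x → L x h))
∘-additive E+ L+ = record
  { ext    = λ f≗g → ext E+ λ x → ext (L+ x) f≗g
  ; +-homo = λ f g → trans (ext E+ λ x → +-homo (L+ x) f g) (+-homo E+ _ _)
  }

eval-additive : ∀ {Y : Set} (y : Y) → IsAdditive (λ h → h y)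
eval-additive y = record { ext = λ f≗g → f≗g y ; +-homo = λ _ _ → refl }

eval-*-additive : ∀ {Y : Set} (y : Y) m → IsAdditive (λ h → h y * m)
eval-*-additive y m = record
  { ext = λ f≗g → cong (_* m) (f≗g y) ; +-homo = λ f g → ℤ.*-distribʳ-+ m (f y) (g y) }

*-eval-additive : ∀ {Y : Set} (y : Y) m → IsAdditive (λ h → m * h y)
*-eval-additive y m = record
  { ext = λ f≗g → cong (m *_) (f≗g y) ; +-homo = λ f g → ℤ.*-distribˡ-+ m (f y) (g y) }

-- Extension by zero, indicator functions and signs

infixl 8 _⊙_

_⊙_ : ∀ {X Y : Set} → (Y → ℤ) → (X → Maybe Y) → X → ℤ
(h ⊙ p) x = maybe′ h 0ℤ (p x)

-- Corresponds to keeping only those coordinates of the vector behind `E` on which `p` is defined.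
restrict : ∀ {X Y : Set} → (X → Maybe Y) → ((X → ℤ) → ℤ) → (Y → ℤ) → ℤ
restrict p E h = E (h ⊙ p)

restrict-additive : ∀ {X Y : Set} (p : X → Maybe Y) {E} → IsAdditive E → IsAdditive (restrict p E)
restrict-additive {Y = Y} p E+ = ∘-additive E+ (λ x → maybe-additive (p x))
  where
  maybe-additive : ∀ m → IsAdditive (λ (h : Y → ℤ) → maybe′ h 0ℤ m)
  maybe-additive (just y) = eval-additive y
  maybe-additive nothing  = record { ext = λ _ → refl ; +-homo = λ _ _ → refl }

indicator : ∀ {X : Set} → DecidableEquality X → X → X → ℤ
indicator _≟_ x y = if does (x ≟ y) then 1ℤ else 0ℤ

module _ {X : Set} (_≟_ : DecidableEquality X) where

  indicator-≡ : ∀ {x y} → x ≡ y → indicator _≟_ x y ≡ 1ℤ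
  indicator-≡ {x} {y} x≡y = cong (if_then 1ℤ else 0ℤ) (dec-true (x ≟ y) x≡y)

  indicator-≢ : ∀ {x y} → x ≢ y → indicator _≟_ x y ≡ 0ℤ
  indicator-≢ {x} {y} x≢y = cong (if_then 1ℤ else 0ℤ) (dec-false (x ≟ y) x≢y)

⟦_⟧ˢ : Sign → ℤ
⟦ Sign.+ ⟧ˢ = 1ℤ
⟦ Sign.- ⟧ˢ = -1ℤ

⟦⟧ˢ-small : ∀ s → Small ⟦ s ⟧ˢ
⟦⟧ˢ-small Sign.+ = small₊
⟦⟧ˢ-small Sign.- = small₋

⟦⟧ˢ-homo-* : ∀ s t → ⟦ s Sign.* t ⟧ˢ ≡ ⟦ s ⟧ˢ * ⟦ t ⟧ˢ
⟦⟧ˢ-homo-* Sign.+ Sign.+ = refl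
⟦⟧ˢ-homo-* Sign.+ Sign.- = refl
⟦⟧ˢ-homo-* Sign.- Sign.+ = refl
⟦⟧ˢ-homo-* Sign.- Sign.- = refl

⟦⟧ˢ-opposite : ∀ s → ⟦ opposite s ⟧ˢ ≡ - ⟦ s ⟧ˢ
⟦⟧ˢ-opposite Sign.+ = refl
⟦⟧ˢ-opposite Sign.- = refl

-- Since -1 and 1 are congruent modulo 2, flipping signs changes each value by an even number, here
-- twice `e x`, and `E` takes twice `e` to twice `E e`.
signed-parity : ∀ {X : Set} {E : (X → ℤ) → ℤ} → IsAdditive E → ∀ h (s : X → Sign) →
                E (λ x → h x * ⟦ s x ⟧ˢ) ≡₂ E h
signed-parity {X} {E} E+ h s = by (E e)
  (trans (ext E+ λ x → split (h x) (s x)) (trans (+-homo E+ h _) (cong (_+_ (E h)) (+-homo E+ e e))))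
  where
  half : ℤ → Sign → ℤ
  half i Sign.+ = 0ℤ
  half i Sign.- = - i

  e : X → ℤ
  e x = half (h x) (s x)

  split : ∀ i s → i * ⟦ s ⟧ˢ ≡ i + (half i s + half i s)
  split i Sign.+ = solve 1 (λ i → i :* con 1ℤ := i :+ (con 0ℤ :+ con 0ℤ)) refl i
  split i Sign.- = solve 1 (λ i → i :* con -1ℤ := i :+ (:- i :+ :- i)) refl i

-- The Sylvester–Hadamard matrix

_≟ᵛ_ : ∀ {k} → DecidableEquality (Vec Bool k)
_≟ᵛ_ = Vec.≡-dec Bool._≟_

-- The sign is minus exactly when `ε` and `b` are both `false` in an odd number of positions.
χ : ∀ {k} → Vec Bool k → Vec Bool k → Sign
χ []          []          = Sign.+
χ (true  ∷ ε) (_     ∷ b) = χ ε b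
χ (false ∷ ε) (true  ∷ b) = χ ε b
χ (false ∷ ε) (false ∷ b) = opposite (χ ε b)

branch : ∀ {k} → Bool → Vec Bool (suc k) → Maybe (Vec Bool k)
branch true  (true  ∷ b) = just b
branch true  (false ∷ b) = nothing
branch false (true  ∷ b) = nothing
branch false (false ∷ b) = just b

indicator-∷ : ∀ {k} t (b : Vec Bool k) → indicator _≟ᵛ_ (t ∷ b) ≗ indicator _≟ᵛ_ b ⊙ branch t
indicator-∷ true  b (true  ∷ _) = refl
indicator-∷ true  b (false ∷ _) = refl
indicator-∷ false b (true  ∷ _) = refl
indicator-∷ false b (false ∷ _) = refl

module _ {k} {E : (Vec Bool (suc k) → ℤ) → ℤ} (E+ : IsAdditive E) (ε : Vec Bool k) where

  private
    u v : ℤ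
    u = restrict (branch true)  E (⟦_⟧ˢ ∘ χ ε)
    v = restrict (branch false) E (⟦_⟧ˢ ∘ χ ε)

  -- The block form of the matrix: H, H above H, -H. Here `u` and `v` are what row `ε` of the
  -- smaller matrix measures on the two halves.
  χ-true : E (⟦_⟧ˢ ∘ χ (true ∷ ε)) ≡ u + v
  χ-true = trans
    (ext E+ λ { (true  ∷ b) → sym (ℤ.+-identityʳ _) ; (false ∷ b) → sym (ℤ.+-identityˡ _) })
    (+-homo E+ _ _)

  χ-false : E (⟦_⟧ˢ ∘ χ (false ∷ ε)) ≡ u - v
  χ-false = trans
    (ext E+ λ { (true  ∷ b) → sym (ℤ.+-identityʳ _)
              ; (false ∷ b) → trans (⟦⟧ˢ-opposite (χ ε b)) (sym (ℤ.+-identityˡ _)) })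
    (trans (+-homo E+ _ _) (cong (_+_ u) (neg-homo E+ ((⟦_⟧ˢ ∘ χ ε) ⊙ branch false))))

-- Sylvester matrices are nonsingular: zero values of `u + v` and `u - v` force `u` and `v` to be
-- zero, and each half is treated by induction.
χ-kernel : ∀ k {E : (Vec Bool k → ℤ) → ℤ} → IsAdditive E →
           (∀ ε → E (⟦_⟧ˢ ∘ χ ε) ≡ 0ℤ) → ∀ b → E (indicator _≟ᵛ_ b) ≡ 0ℤ
χ-kernel zero    E+ χ≡0 [] = trans (ext E+ λ { [] → refl }) (χ≡0 [])
χ-kernel (suc k) {E} E+ χ≡0 (t ∷ b) = trans (ext E+ (indicator-∷ t b))
  (χ-kernel k (restrict-additive (branch t) E+) (half t) b)
  where
  halves : ∀ ε → restrict (branch true)  E (⟦_⟧ˢ ∘ χ ε) ≡ 0ℤ ×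
                 restrict (branch false) E (⟦_⟧ˢ ∘ χ ε) ≡ 0ℤ
  halves ε = zero-± _ _ (trans (sym (χ-true  E+ ε)) (χ≡0 (true  ∷ ε)))
                        (trans (sym (χ-false E+ ε)) (χ≡0 (false ∷ ε)))

  half : ∀ t ε → restrict (branch t) E (⟦_⟧ˢ ∘ χ ε) ≡ 0ℤ
  half true  ε = proj₁ (halves ε)
  half false ε = proj₂ (halves ε)

-- In the induction step, one half contributes even and the other odd values to
-- all the sums, the same half for every i and ε; being small, the even ones vanish.
χ-concentrates : ∀ k {I : Set} (E : I → (Vec Bool k → ℤ) → ℤ) (P : (Vec Bool k → ℤ) → ℤ) →
                 (∀ i → IsAdditive (E i)) → (∀ i h → E i h ≡₂ P h) →
                 (∀ i ε → Small (E i (⟦_⟧ˢ ∘ χ ε))) →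
                 ∃[ b₀ ] (∀ b → b ≢ b₀ → ∀ i → E i (indicator _≟ᵛ_ b) ≡ 0ℤ)
χ-concentrates zero    E P E+ E≡P small = [] , λ { [] []≢[] → contradiction refl []≢[] }
χ-concentrates (suc k) {I} E P E+ E≡P small = result (even⊎odd (P ((const 1ℤ) ⊙ branch true)))
  where
  half : Bool → I → (Vec Bool k → ℤ) → ℤ
  half t i = restrict (branch t) (E i)

  half+ : ∀ t i → IsAdditive (half t i)
  half+ t i = restrict-additive (branch t) (E+ i)

  halves : ∀ i ε → (half true i (⟦_⟧ˢ ∘ χ ε) ≡ 0ℤ × Small (half false i (⟦_⟧ˢ ∘ χ ε))) ⊎
                   (half false i (⟦_⟧ˢ ∘ χ ε) ≡ 0ℤ × Small (half true i (⟦_⟧ˢ ∘ χ ε)))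
  halves i ε = small-± (half true i (⟦_⟧ˢ ∘ χ ε)) (half false i (⟦_⟧ˢ ∘ χ ε))
                       (subst Small (χ-true  (E+ i) ε) (small i (true  ∷ ε)))
                       (subst Small (χ-false (E+ i) ε) (small i (false ∷ ε)))

  -- `signed-parity` removes the dependence on `ε` and `E≡P` that on `i`, so one parity decides
  -- which half survives for all of them.
  parity : ∀ i ε → half true i (⟦_⟧ˢ ∘ χ ε) ≡₂ P (const 1ℤ ⊙ branch true)
  parity i ε = ≡₂-trans
    (subst (_≡₂ half true i (const 1ℤ)) (ext (half+ true i) λ b → ℤ.*-identityˡ _)
           (signed-parity (half+ true i) (const 1ℤ) (χ ε)))
    (E≡P i _)

  Vanishes : Bool → Set
  Vanishes t = ∀ i ε → half t i (⟦_⟧ˢ ∘ χ ε) ≡ 0ℤ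

  in-half : ∀ t → (∀ t′ → t′ ≢ t → Vanishes t′) → (∀ i ε → Small (half t i (⟦_⟧ˢ ∘ χ ε))) →
            ∃[ b₀ ] (∀ b → b ≢ b₀ → ∀ i → E i (indicator _≟ᵛ_ b) ≡ 0ℤ)
  in-half t vanishes small-t
    with b₀ , vanish ← χ-concentrates k (half t) (restrict (branch t) P) (half+ t)
                         (λ i h → E≡P i _) small-t
    = t ∷ b₀ , elsewhere
    where
    elsewhere : ∀ b → b ≢ t ∷ b₀ → ∀ i → E i (indicator _≟ᵛ_ b) ≡ 0ℤ
    elsewhere (t′ ∷ b) b≢ i with t′ Bool.≟ t
    ... | yes refl = trans (ext (E+ i) (indicator-∷ t b)) (vanish b (b≢ ∘ cong (t ∷_)) i)
    ... | no t′≢t  = trans (ext (E+ i) (indicator-∷ t′ b))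
                           (χ-kernel k (half+ t′ i) (vanishes t′ t′≢t i) b)

  result : P (const 1ℤ ⊙ branch true) ≡₂ 0ℤ ⊎ P (const 1ℤ ⊙ branch true) ≡₂ 1ℤ →
           ∃[ b₀ ] (∀ b → b ≢ b₀ → ∀ i → E i (indicator _≟ᵛ_ b) ≡ 0ℤ)
  result (inj₁ even) = in-half false
    (λ { true _ i ε → proj₁ (true-vanishes i ε) ; false f≢f → contradiction refl f≢f })
    (λ i ε → proj₂ (true-vanishes i ε))
    where
    true-vanishes : ∀ i ε → half true i (⟦_⟧ˢ ∘ χ ε) ≡ 0ℤ × Small (half false i (⟦_⟧ˢ ∘ χ ε))
    true-vanishes i ε with halves i ε
    ... | inj₁ both             = both
    -- The false half vanishes in this case; the true half is small and even, so it vanishes too.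
    ... | inj₂ (v≡0 , small-u) =
      small-even small-u (≡₂-trans (parity i ε) even) , subst Small (sym v≡0) small₀
  result (inj₂ odd) = in-half true
    (λ { false _ i ε → proj₁ (false-vanishes i ε) ; true t≢t → contradiction refl t≢t })
    (λ i ε → proj₂ (false-vanishes i ε))
    where
    false-vanishes : ∀ i ε → half false i (⟦_⟧ˢ ∘ χ ε) ≡ 0ℤ × Small (half true i (⟦_⟧ˢ ∘ χ ε))
    false-vanishes i ε with halves i ε
    ... | inj₁ (u≡0 , _) = contradiction u≡0 (odd≢0 (≡₂-trans (parity i ε) odd))
    ... | inj₂ both      = both

-- The Cantor–Mills detecting matrix

Column : ℕ → Set
Column zero    = ⊤
Column (suc k) = (Column k ⊎ Column k) ⊎ Vec Bool k

_≟ᶜ_ : ∀ {k} → DecidableEquality (Column k)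
_≟ᶜ_ {zero}  = Unit._≟_
_≟ᶜ_ {suc k} = Sum.≡-dec (Sum.≡-dec _≟ᶜ_ _≟ᶜ_) _≟ᵛ_

-- With nothing read as 0, the matrix D is (1) for k = 0, and then D, D, I above
-- D, -D, 0.
entry : ∀ {k} → Vec Bool k → Column k → Maybe Sign
entry []          tt              = just Sign.+
entry (_     ∷ ρ) (inj₁ (inj₁ c)) = entry ρ c
entry (true  ∷ ρ) (inj₁ (inj₂ c)) = entry ρ c
entry (false ∷ ρ) (inj₁ (inj₂ c)) = map opposite (entry ρ c)
entry (true  ∷ ρ) (inj₂ σ)        = if does (ρ ≟ᵛ σ) then just Sign.+ else nothing
entry (false ∷ ρ) (inj₂ σ)        = nothing

⟦_⟧ᵐ : Maybe Sign → ℤ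
⟦_⟧ᵐ = maybe′ ⟦_⟧ˢ 0ℤ

left? right? : ∀ {k} → Column (suc k) → Maybe (Column k)
left? (inj₁ (inj₁ c)) = just c
left? (inj₁ (inj₂ c)) = nothing
left? (inj₂ σ)        = nothing
right? (inj₁ (inj₁ c)) = nothing
right? (inj₁ (inj₂ c)) = just c
right? (inj₂ σ)        = nothing

extra? : ∀ {k} → Column (suc k) → Maybe (Vec Bool k)
extra? (inj₁ _) = nothing
extra? (inj₂ σ) = just σ

indicator-left : ∀ {k} (c : Column k) →
  indicator _≟ᶜ_ (inj₁ (inj₁ c)) ≗ indicator _≟ᶜ_ c ⊙ left?
indicator-left c (inj₁ (inj₁ _)) = refl
indicator-left c (inj₁ (inj₂ _)) = refl
indicator-left c (inj₂ _)        = refl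

indicator-right : ∀ {k} (c : Column k) →
  indicator _≟ᶜ_ (inj₁ (inj₂ c)) ≗ indicator _≟ᶜ_ c ⊙ right?
indicator-right c (inj₁ (inj₁ _)) = refl
indicator-right c (inj₁ (inj₂ _)) = refl
indicator-right c (inj₂ _)        = refl

indicator-extra : ∀ {k} (σ : Vec Bool k) →
  indicator (_≟ᶜ_ {suc k}) (inj₂ σ) ≗ indicator _≟ᵛ_ σ ⊙ extra?
indicator-extra σ (inj₁ _) = refl
indicator-extra σ (inj₂ _) = refl

-- The sum of the two values measured by rows true ∷ ρ and false ∷ ρ is even apart
-- from the contribution of the extra column ρ, which must vanish because it is small.
entry-kernel : ∀ k {E : (Column k → ℤ) → ℤ} → IsAdditive E →
               (∀ c → Small (E (indicator _≟ᶜ_ c))) → (∀ ρ → E (⟦_⟧ᵐ ∘ entry ρ) ≡ 0ℤ) →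
               ∀ c → E (indicator _≟ᶜ_ c) ≡ 0ℤ
entry-kernel zero    E+ small D≡0 tt = trans (ext E+ λ _ → refl) (D≡0 [])
entry-kernel (suc k) {E} E+ small D≡0 = vanish
  where
  X Y : (Column k → ℤ) → ℤ
  X = restrict left? E
  Y = restrict right? E

  Z : (Vec Bool k → ℤ) → ℤ
  Z = restrict extra? E

  module _ (ρ : Vec Bool k) where

    x y z : ℤ
    x = X (⟦_⟧ᵐ ∘ entry ρ)
    y = Y (⟦_⟧ᵐ ∘ entry ρ)
    z = Z (indicator _≟ᵛ_ ρ)

    D-true : x + y + z ≡ 0ℤ
    D-true = trans (sym (trans (ext E+ pointwise)
      (trans (+-homo E+ _ _) (cong (_+ z) (+-homo E+ _ _))))) (D≡0 (true ∷ ρ))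
      where
      pointwise : ∀ c → ⟦ entry (true ∷ ρ) c ⟧ᵐ ≡
        ((⟦_⟧ᵐ ∘ entry ρ) ⊙ left?) c + ((⟦_⟧ᵐ ∘ entry ρ) ⊙ right?) c +
        (indicator _≟ᵛ_ ρ ⊙ extra?) c
      pointwise (inj₁ (inj₁ c)) = sym (trans (ℤ.+-identityʳ _) (ℤ.+-identityʳ _))
      pointwise (inj₁ (inj₂ c)) = sym (trans (ℤ.+-identityʳ _) (ℤ.+-identityˡ _))
      pointwise (inj₂ σ) with does (ρ ≟ᵛ σ)
      ... | true  = refl
      ... | false = refl

    D-false : x - y ≡ 0ℤ
    D-false = trans (sym (trans (ext E+ pointwise)
      (trans (+-homo E+ _ _) (cong (_+_ x) (neg-homo E+ _))))) (D≡0 (false ∷ ρ))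
      where
      map-opposite : ∀ m → ⟦ map opposite m ⟧ᵐ ≡ - ⟦ m ⟧ᵐ
      map-opposite (just s) = ⟦⟧ˢ-opposite s
      map-opposite nothing  = refl

      pointwise : ∀ c → ⟦ entry (false ∷ ρ) c ⟧ᵐ ≡
        ((⟦_⟧ᵐ ∘ entry ρ) ⊙ left?) c + - ((⟦_⟧ᵐ ∘ entry ρ) ⊙ right?) c
      pointwise (inj₁ (inj₁ c)) = sym (ℤ.+-identityʳ _)
      pointwise (inj₁ (inj₂ c)) = trans (map-opposite (entry ρ c)) (sym (ℤ.+-identityˡ _))
      pointwise (inj₂ σ)        = refl

    z≡0 : z ≡ 0ℤ
    z≡0 = small-even (subst Small (ext E+ (indicator-extra ρ)) (small (inj₂ ρ)))
      -- `z` is the sum of the two zero values `x + y + z` and `x - y`, minus `2x`.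
      (by (- x) (trans
        (solve 3 (λ x y z → z := (x :+ y :+ z) :+ (x :- y) :+ (:- x :+ :- x)) refl x y z)
        (cong₂ (λ i j → i + j + (- x + - x)) D-true D-false)))

    x≡0×y≡0 : x ≡ 0ℤ × y ≡ 0ℤ
    x≡0×y≡0 = zero-± x y
      (trans (sym (ℤ.+-identityʳ _)) (trans (cong (_+_ (x + y)) (sym z≡0)) D-true)) D-false

  vanish : ∀ c → E (indicator _≟ᶜ_ c) ≡ 0ℤ
  vanish (inj₁ (inj₁ c)) = trans (ext E+ (indicator-left c))
    (entry-kernel k (restrict-additive left? E+)
      (λ c → subst Small (ext E+ (indicator-left c)) (small (inj₁ (inj₁ c))))
      (proj₁ ∘ x≡0×y≡0) c)
  vanish (inj₁ (inj₂ c)) = trans (ext E+ (indicator-right c))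
    (entry-kernel k (restrict-additive right? E+)
      (λ c → subst Small (ext E+ (indicator-right c)) (small (inj₁ (inj₂ c))))
      (proj₂ ∘ x≡0×y≡0) c)
  vanish (inj₂ σ) = trans (ext E+ (indicator-extra σ)) (z≡0 σ)

-- The filled Cantor-Mills matrix

fill : Bool → Maybe Sign → Sign
fill _     (just s) = s
fill true  nothing  = Sign.+
fill false nothing  = Sign.-

fill-sum : ∀ m → ⟦ fill true m ⟧ˢ + ⟦ fill false m ⟧ˢ ≡ ⟦ m ⟧ᵐ + ⟦ m ⟧ᵐ
fill-sum (just s) = refl
fill-sum nothing  = refl

filled : ∀ {k} → Vec Bool (suc k) → Column k → Sign
filled (t ∷ ρ) c = fill t (entry ρ c)

-- The two fillings of a row add up to twice the row, so a functional vanishing on both vanishes on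
-- the row itself.
filled-kernel : ∀ k {E : (Column k → ℤ) → ℤ} → IsAdditive E →
                (∀ c → Small (E (indicator _≟ᶜ_ c))) → (∀ ρ → E (⟦_⟧ˢ ∘ filled ρ) ≡ 0ℤ) →
                ∀ c → E (indicator _≟ᶜ_ c) ≡ 0ℤ
filled-kernel k {E} E+ small D≡0 = entry-kernel k E+ small λ ρ → double-zero (begin
  E (⟦_⟧ᵐ ∘ entry ρ) + E (⟦_⟧ᵐ ∘ entry ρ)                     ≡⟨ +-homo E+ _ _ ⟨
  E (λ c → ⟦ entry ρ c ⟧ᵐ + ⟦ entry ρ c ⟧ᵐ)                   ≡⟨ ext E+ (λ c → fill-sum (entry ρ c)) ⟨
  E (λ c → ⟦ filled (true ∷ ρ) c ⟧ˢ + ⟦ filled (false ∷ ρ) c ⟧ˢ) ≡⟨ +-homo E+ _ _ ⟩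
  E (⟦_⟧ˢ ∘ filled (true ∷ ρ)) + E (⟦_⟧ˢ ∘ filled (false ∷ ρ)) ≡⟨ cong₂ _+_ (D≡0 (true ∷ ρ)) (D≡0 (false ∷ ρ)) ⟩
  0ℤ ∎)
  where
  open ≡-Reasoning

  double-zero : ∀ {i} → i + i ≡ 0ℤ → i ≡ 0ℤ
  double-zero {i} i+i≡0 = proj₁ (zero-± i i i+i≡0 (ℤ.+-inverseʳ i))

-- Finite sums

sum-zero : ∀ {d} {t : Fin d → ℤ} → (∀ j → t j ≡ 0ℤ) → sum t ≡ 0ℤ
sum-zero {d} t≡0 = trans (sum-cong-≗ t≡0) (sum-replicate-zero d)

sum-single : ∀ {d} (t : Fin d → ℤ) i → (∀ j → j ≢ i → t j ≡ 0ℤ) → sum t ≡ t i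
sum-single {suc d} t i t≡0 = trans (sum-remove {i = i} t)
  (trans (cong (_+_ (t i)) (sum-zero λ j → t≡0 (punchIn i j) (punchInᵢ≢i i j)))
         (ℤ.+-identityʳ (t i)))

sum-*-difference : ∀ {d} (x y s : Fin d → ℤ) →
  sum (λ j → x j * s j) - sum (λ j → y j * s j) ≡ sum (λ j → (x j - y j) * s j)
sum-*-difference {zero}  x y s = refl
sum-*-difference {suc d} x y s = trans
  (solve 5 (λ x y s p q → (x :* s :+ p) :- (y :* s :+ q) := (x :- y) :* s :+ (p :- q)) refl
     (x zero) (y zero) (s zero) _ _)
  (cong (_+_ ((x zero - y zero) * s zero)) (sum-*-difference (x ∘ suc) (y ∘ suc) (s ∘ suc)))

sum-additive : ∀ {X : Set} {d} (w : Fin d → ℤ) (φ : Fin d → X) →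
               IsAdditive (λ h → sum (λ j → w j * h (φ j)))
sum-additive w φ = record
  { ext    = λ f≗g → sum-cong-≗ λ j → cong (w j *_) (f≗g (φ j))
  ; +-homo = λ f g → trans (sum-cong-≗ λ j → ℤ.*-distribˡ-+ (w j) (f (φ j)) (g (φ j)))
                           (∑-distrib-+ (λ j → w j * f (φ j)) (λ j → w j * g (φ j)))
  }

-- Sign vectors separating the nonadjacent vertices

-- The first kind of row is the tensor product of the Sylvester matrix and the filled
-- Cantor–Mills matrix; the second is the Sylvester matrix applied to the sum of all blocks.
Row : ℕ → Set
Row k = (Vec Bool (suc k) × Vec Bool k) ⊎ Vec Bool (k ℕ.+ k)

module _ {k} (ι : Column k → Vec Bool (k ℕ.+ k)) where

  row : Row k → Vec Bool k × Column k → Sign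
  row (inj₁ (ρ , ε)) (b , c) = χ ε b Sign.* filled ρ c
  row (inj₂ ε)       (b , c) = χ ε (ι c)

  -- `φ` places each position in a block and a column. The first kind of row confines the support of
  -- `w` to one block, the second to one value of `ι` on the columns; injectivity of `φ` and `ι`
  -- then leaves at most one position.
  rows-isolate : Injective _≡_ _≡_ ι → ∀ {d} (φ : Fin d → Vec Bool k × Column k) →
    Injective _≡_ _≡_ φ → (w : Fin d → ℤ) → (∀ j → Small (w j)) →
    (∀ r → Small (sum (λ j → w j * ⟦ row r (φ j) ⟧ˢ))) →
    ∀ i j → w i ≢ 0ℤ → w j ≢ 0ℤ → i ≡ j
  rows-isolate ι-inj {d} φ φ-inj w w-small row-small = isolated
    where
    E : (Vec Bool k × Column k → ℤ) → ℤ
    E h = sum (λ j → w j * h (φ j))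

    E+ : IsAdditive E
    E+ = sum-additive w φ

    block : Fin d → Vec Bool k
    block = proj₁ ∘ φ

    column : Fin d → Column k
    column = proj₂ ∘ φ

    blocks : ∃[ b₀ ] (∀ b → b ≢ b₀ → ∀ ρ →
               E (λ (b′ , c) → indicator _≟ᵛ_ b b′ * ⟦ filled ρ c ⟧ˢ) ≡ 0ℤ)
    -- One functional on the blocks for each filled row `ρ`. As filled entries are all odd, these
    -- functionals agree modulo 2, which a matrix with zeros would not give.
    blocks = χ-concentrates k (λ ρ h → E (λ (b , c) → h b * ⟦ filled ρ c ⟧ˢ)) (λ h → E (h ∘ proj₁))
      (λ ρ → ∘-additive E+ (λ (b , c) → eval-*-additive b ⟦ filled ρ c ⟧ˢ))
      (λ ρ h → signed-parity E+ (h ∘ proj₁) (filled ρ ∘ proj₂))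
      (λ ρ ε → subst Small (ext E+ λ (b , c) → ⟦⟧ˢ-homo-* (χ ε b) (filled ρ c))
                           (row-small (inj₁ (ρ , ε))))

    b₀ : Vec Bool k
    b₀ = proj₁ blocks

    -- For a block other than `b₀`, the functional `F` is `w` restricted to that block. It vanishes
    -- on all filled rows, and its coordinates are values of `w` or 0, so the filled matrix detects
    -- that it is zero.
    outside : ∀ j → block j ≢ b₀ → w j ≡ 0ℤ
    outside i b≢b₀ = trans (sym (F-at i refl refl))
      (filled-kernel k F+ F-small (proj₂ blocks b b≢b₀) (column i))
      where
      b : Vec Bool k
      b = block i

      F : (Column k → ℤ) → ℤ
      F h = E (λ (b′ , c) → indicator _≟ᵛ_ b b′ * h c)

      F+ : IsAdditive F
      F+ = ∘-additive E+ λ (b′ , c) → *-eval-additive c (indicator _≟ᵛ_ b b′)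

      F-off : ∀ {c} j → ¬ (b ≡ block j × c ≡ column j) →
              w j * (indicator _≟ᵛ_ b (block j) * indicator _≟ᶜ_ c (column j)) ≡ 0ℤ
      F-off {c} j ≢φj with b ≟ᵛ block j
      ... | no  _  = ℤ.*-zeroʳ (w j)
      ... | yes b≡ = trans
        (cong (λ z → w j * (1ℤ * z)) (indicator-≢ _≟ᶜ_ λ c≡ → ≢φj (b≡ , c≡)))
        (ℤ.*-zeroʳ (w j))

      F-at : ∀ {c} j → b ≡ block j → c ≡ column j → F (indicator _≟ᶜ_ c) ≡ w j
      F-at j b≡ c≡ = trans
        (sum-single _ j λ j′ j′≢j → F-off j′ λ (b≡′ , c≡′) →
          j′≢j (φ-inj (cong₂ _,_ (trans (sym b≡′) b≡) (trans (sym c≡′) c≡))))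
        (trans (cong₂ (λ x y → w j * (x * y)) (indicator-≡ _≟ᵛ_ b≡) (indicator-≡ _≟ᶜ_ c≡))
               (ℤ.*-identityʳ (w j)))

      F-small : ∀ c → Small (F (indicator _≟ᶜ_ c))
      F-small c with any? (λ j → (b ≟ᵛ block j) ×-dec (c ≟ᶜ column j))
      ... | yes (j , b≡ , c≡) = subst Small (sym (F-at j b≡ c≡)) (w-small j)
      ... | no  none = subst Small (sym (sum-zero λ j → F-off j λ eqs → none (j , eqs))) small₀

    G : (Vec Bool (k ℕ.+ k) → ℤ) → ℤ
    G h = E (λ (b , c) → h (ι c))

    G+ : IsAdditive G
    G+ = ∘-additive E+ (λ (b , c) → eval-additive (ι c))

    columns : ∃[ σ₀ ] (∀ σ → σ ≢ σ₀ → ∀ (_ : ⊤) → G (indicator _≟ᵛ_ σ) ≡ 0ℤ)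
    -- There is a single functional `G` here, so the parity condition is met by taking `G` for `P`.
    columns = χ-concentrates (k ℕ.+ k) (const G) G (const G+)
      (λ _ h → by 0ℤ (sym (ℤ.+-identityʳ _))) (λ _ ε → row-small (inj₂ ε))

    support : ∀ i → w i ≢ 0ℤ → block i ≡ b₀ × ι (column i) ≡ proj₁ columns
    support i wi≢0 = in-block i wi≢0 , decidable-stable (_ ≟ᵛ _) λ σ≢σ₀ →
      wi≢0 (trans (sym G-at) (proj₂ columns (ι (column i)) σ≢σ₀ tt))
      where
      in-block : ∀ j → w j ≢ 0ℤ → block j ≡ b₀
      in-block j wj≢0 = decidable-stable (_ ≟ᵛ _) (wj≢0 ∘ outside j)

      -- Adding up the blocks loses nothing: `w` is zero outside block `b₀`, and inside it distinct
      -- positions have distinct columns.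
      G-off : ∀ j → j ≢ i → w j * indicator _≟ᵛ_ (ι (column i)) (ι (column j)) ≡ 0ℤ
      G-off j j≢i with w j ℤ.≟ 0ℤ
      ... | yes wj≡0 = cong (_* indicator _≟ᵛ_ (ι (column i)) (ι (column j))) wj≡0
      ... | no  wj≢0 = trans
        (cong (w j *_) (indicator-≢ _≟ᵛ_ λ σ≡ → j≢i (φ-inj
          (cong₂ _,_ (trans (in-block j wj≢0) (sym (in-block i wi≢0))) (ι-inj (sym σ≡))))))
        (ℤ.*-zeroʳ (w j))

      G-at : G (indicator _≟ᵛ_ (ι (column i))) ≡ w i
      G-at = trans (sum-single _ i G-off)
        (trans (cong (w i *_) (indicator-≡ _≟ᵛ_ {ι (column i)} refl)) (ℤ.*-identityʳ (w i)))

    isolated : ∀ i j → w i ≢ 0ℤ → w j ≢ 0ℤ → i ≡ j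
    isolated i j wi≢0 wj≢0 with support i wi≢0 | support j wj≢0
    ... | bi , σi | bj , σj = φ-inj (cong₂ _,_ (trans bi (sym bj)) (ι-inj (trans σi (sym σj))))

-- Boxes from integer-valued functions

ℤ→ℚ : ℤ → ℚ
ℤ→ℚ i = mkℚ i 0 (coprime-sym (1-coprimeTo ∣ i ∣))

fromℤ : ℤ → ℝ
fromℤ i = fromℚ (ℤ→ℚ i)

fromℤ-mono-≤ : ∀ {i j} → i ℤ.≤ j → fromℤ i ≤ʳ fromℤ j
fromℤ-mono-≤ i≤j q (r , q<r , r≤i) =
  r , q<r , ℚ.≤-trans r≤i (ℚ.*≤* (ℤ.*-monoʳ-≤-nonNeg (+ 1) i≤j))

fromℤ-cancel-≤ : ∀ {i j} → fromℤ i ≤ʳ fromℤ j → i ℤ.≤ j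
fromℤ-cancel-≤ {i} {j} le = ℤ.≮⇒≥ λ j<i →
  let r , j<r , r≤j = le (ℤ→ℚ j) (ℤ→ℚ i , ℚ.*<* (ℤ.*-monoʳ-<-pos (+ 1) j<i) , ℚ.≤-refl)
  in ℚ.<-irrefl refl (ℚ.<-≤-trans j<r r≤j)

-- In the coordinate of `r`, vertex `v` gets the unit interval starting at `g r v`. When all these
-- intervals meet pairwise, the larger left endpoints form a common point of the two boxes.
functions⇒boxes : ∀ G {R : Set} {n} → R ↔ Fin n → (g : R → Vertex G → ℤ) →
  (∀ u v → u ≢ v → Adj G u v ⇔ (∀ r → Small (g r u - g r v))) → BoxRepresentable G n
functions⇒boxes G {R} {n} R↔Fin g separates = B , λ u v u≢v →
  mk⇔ (meet u v ∘ Equivalence.to (separates u v u≢v))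
      (Equivalence.from (separates u v u≢v) ∘ close u v)
  where
  open Inverse R↔Fin using (to; from; strictlyInverseʳ)

  B : Vertex G → Box n
  B v i = record { lo = fromℤ (g (from i) v) ; hi = fromℤ (1ℤ + g (from i) v)
                 ; lo≤hi = fromℤ-mono-≤ (ℤ.i≤j+i (g (from i) v) 1ℤ) }

  meet : ∀ u v → (∀ r → Small (g r u - g r v)) → ⟦ B u ⟧ ≬ ⟦ B v ⟧
  meet u v small = (λ i → fromℤ (g (from i) u ℤ.⊔ g (from i) v)) ,
    (λ i → fromℤ-mono-≤ (ℤ.i≤i⊔j (g (from i) u) _) ,
           fromℤ-mono-≤ (ℤ.⊔-lub (ℤ.i≤j+i (g (from i) u) 1ℤ) (proj₂ (near i)))) ,
    (λ i → fromℤ-mono-≤ (ℤ.i≤j⊔i (g (from i) u) _) ,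
           fromℤ-mono-≤ (ℤ.⊔-lub (proj₁ (near i)) (ℤ.i≤j+i (g (from i) v) 1ℤ)))
    where
    near : ∀ i → g (from i) u ℤ.≤ 1ℤ + g (from i) v × g (from i) v ℤ.≤ 1ℤ + g (from i) u
    near i = Equivalence.to small-difference (small (from i))

  close : ∀ u v → ⟦ B u ⟧ ≬ ⟦ B v ⟧ → ∀ r → Small (g r u - g r v)
  close u v (x , x∈u , x∈v) r = subst (λ r → Small (g r u - g r v)) (strictlyInverseʳ r)
    (Equivalence.from small-difference
      ( fromℤ-cancel-≤ (≤ʳ-trans (lo (B u i)) (x i) (hi (B v i)) (proj₁ (x∈u i)) (proj₂ (x∈v i)))
      , fromℤ-cancel-≤ (≤ʳ-trans (lo (B v i)) (x i) (hi (B u i)) (proj₁ (x∈v i)) (proj₂ (x∈u i)))))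
    where
    i : Fin n
    i = to r

-- The boxicity of the hypercube

bit : Bool → ℤ
bit true  = 1ℤ
bit false = 0ℤ

bit-difference-small : ∀ x y → Small (bit x - bit y)
bit-difference-small true  true  = small₀
bit-difference-small true  false = small₊
bit-difference-small false true  = small₋
bit-difference-small false false = small₀

bit-difference-≡0 : ∀ x y → x ≡ y → bit x - bit y ≡ 0ℤ
bit-difference-≡0 x y refl = ℤ.+-inverseʳ (bit x)

bit-difference-≢0 : ∀ x y → x ≢ y → bit x - bit y ≢ 0ℤ
bit-difference-≢0 true  true  x≢y _ = x≢y refl
bit-difference-≢0 false false x≢y _ = x≢y refl
bit-difference-≢0 true  false _ ()
bit-difference-≢0 false true  _ ()

small-*-sign : ∀ {i} → Small i → ∀ s → Small (i * ⟦ s ⟧ˢ)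
small-*-sign small₋ Sign.+ = small₋
small-*-sign small₋ Sign.- = small₊
small-*-sign small₀ _      = small₀
small-*-sign small₊ Sign.+ = small₊
small-*-sign small₊ Sign.- = small₋

differing-position : ∀ {d} (u v : Vec Bool d) → u ≢ v → ∃[ i ] lookup u i ≢ lookup v i
differing-position u v u≢v with any? (λ i → ¬? (lookup u i Bool.≟ lookup v i))
... | yes position = position
... | no  none     = contradiction
  (trans (sym (Vec.tabulate∘lookup u)) (trans
    (Vec.tabulate-cong λ i → decidable-stable (lookup u i Bool.≟ lookup v i) λ u≢ → none (i , u≢))
    (Vec.tabulate∘lookup v)))
  u≢v

#columns : ℕ → ℕ
#columns zero    = 1
#columns (suc k) = #columns k ℕ.+ #columns k ℕ.+ 2 ℕ.^ k

-- Equal to 3 · 4^k, with one summand for each kind of row.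
#rows : ℕ → ℕ
#rows k = 2 ℕ.^ suc k ℕ.* 2 ℕ.^ k ℕ.+ 2 ℕ.^ (k ℕ.+ k)

strings↔Fin : ∀ k → Vec Bool k ↔ Fin (2 ℕ.^ k)
strings↔Fin k = enumeration (hypercube k)

Column↔Fin : ∀ k → Column k ↔ Fin (#columns k)
Column↔Fin zero    = ↔-sym 1↔⊤
Column↔Fin (suc k) = ↔-trans
  (↔-trans (Column↔Fin k ⊎-↔ Column↔Fin k) (↔-sym +↔⊎) ⊎-↔ strings↔Fin k) (↔-sym +↔⊎)

Row↔Fin : ∀ k → Row k ↔ Fin (#rows k)
Row↔Fin k = ↔-trans
  (↔-trans (strings↔Fin (suc k) ×-↔ strings↔Fin k) (↔-sym *↔×) ⊎-↔ strings↔Fin (k ℕ.+ k))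
  (↔-sym +↔⊎)

embedding : ∀ {X Y : Set} {m n} → X ↔ Fin m → Y ↔ Fin n → m ≤ n → X ↣ Y
embedding X↔m Y↔n m≤n = ↔⇒↣ (↔-sym Y↔n) ↣-∘ (mk↣ (inject≤-injective m≤n m≤n _ _) ↣-∘ ↔⇒↣ X↔m)

-- This crude bound makes room for the columns among the 4^k positions of the larger Sylvester
-- matrix.
#columns≤2^k+k : ∀ k → #columns k ≤ 2 ℕ.^ (k ℕ.+ k)
#columns≤2^k+k zero    = ℕ.≤-refl
#columns≤2^k+k (suc k) = begin
  #columns k ℕ.+ #columns k ℕ.+ 2 ℕ.^ k
    ≤⟨ ℕ.+-mono-≤ (ℕ.+-mono-≤ (#columns≤2^k+k k) (#columns≤2^k+k k))
                  (ℕ.^-monoʳ-≤ 2 (ℕ.m≤m+n k k)) ⟩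
  Q ℕ.+ Q ℕ.+ Q
    ≤⟨ ℕ.m≤m+n _ Q ⟩
  Q ℕ.+ Q ℕ.+ Q ℕ.+ Q
    ≡⟨ solveℕ 1 (λ q → q +ℕ q +ℕ q +ℕ q ≔ conℕ 2 *ℕ (conℕ 2 *ℕ q)) refl Q ⟩
  2 ℕ.^ suc (suc (k ℕ.+ k))
    ≡⟨ cong (λ n → 2 ℕ.^ suc n) (ℕ.+-suc k k) ⟨
  2 ℕ.^ (suc k ℕ.+ suc k) ∎
  where
  open ℕ.≤-Reasoning
  Q = 2 ℕ.^ (k ℕ.+ k)

-- Adjacent strings differ by a vector with a single nonzero entry 1 or -1, on which every row is
-- small. Conversely, `rows-isolate` allows at most one differing position, and distinct strings
-- have at least one.
hypercube-boxes : ∀ k {d} → d ≤ 2 ℕ.^ k ℕ.* #columns k → BoxRepresentable (hypercube d) (#rows k)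
hypercube-boxes k {d} d≤ = functions⇒boxes (hypercube d) (Row↔Fin k) g λ u v u≢v →
  mk⇔ (λ uv r → subst Small (sym (g-difference r u v)) (adjacent-small u v uv r))
      (λ small → isolated-adjacent u v u≢v λ r → subst Small (g-difference r u v) (small r))
  where
  open Injection (embedding (Column↔Fin k) (strings↔Fin (k ℕ.+ k)) (#columns≤2^k+k k))
    using () renaming (to to ι; injective to ι-injective)
  open Injection (embedding ↔-refl (↔-trans (strings↔Fin k ×-↔ Column↔Fin k) (↔-sym *↔×)) d≤)
    using () renaming (to to φ; injective to φ-injective)

  g : Row k → Vec Bool d → ℤ
  g r u = sum (λ j → bit (lookup u j) * ⟦ row ι r (φ j) ⟧ˢ)

  difference : Vec Bool d → Vec Bool d → Fin d → ℤ
  difference u v j = bit (lookup u j) - bit (lookup v j)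

  g-difference : ∀ r u v → g r u - g r v ≡ sum (λ j → difference u v j * ⟦ row ι r (φ j) ⟧ˢ)
  g-difference r u v = sum-*-difference (bit ∘ lookup u) (bit ∘ lookup v) (λ j → ⟦ row ι r (φ j) ⟧ˢ)

  adjacent-small : ∀ u v → Adj (hypercube d) u v → ∀ r →
                   Small (sum (λ j → difference u v j * ⟦ row ι r (φ j) ⟧ˢ))
  adjacent-small u v (i , _ , unique) r = subst Small
    (sym (sum-single _ i λ j j≢i → cong (_* ⟦ row ι r (φ j) ⟧ˢ)
      (bit-difference-≡0 _ _ (decidable-stable (lookup u j Bool.≟ lookup v j) λ u≢v →
        j≢i (sym (unique u≢v))))))
    (small-*-sign (bit-difference-small (lookup u i) (lookup v i)) (row ι r (φ i)))

  isolated-adjacent : ∀ u v → u ≢ v →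
    (∀ r → Small (sum (λ j → difference u v j * ⟦ row ι r (φ j) ⟧ˢ))) → Adj (hypercube d) u v
  isolated-adjacent u v u≢v small with differing-position u v u≢v
  ... | i , ui≢vi = i , ui≢vi , λ {j} uj≢vj →
    rows-isolate ι ι-injective φ φ-injective (difference u v)
      (λ j → bit-difference-small (lookup u j) (lookup v j)) small i j
      (bit-difference-≢0 _ _ ui≢vi) (bit-difference-≢0 _ _ uj≢vj)

-- The number of rows

-- Doubling avoids the exponent k - 1 in the closed form (k + 2) · 2^(k - 1).
2#columns≡ : ∀ k → #columns k ℕ.+ #columns k ≡ (2 ℕ.+ k) ℕ.* 2 ℕ.^ k
2#columns≡ zero    = refl
2#columns≡ (suc k) = trans
  (solveℕ 2 (λ n q → (n +ℕ n +ℕ q) +ℕ (n +ℕ n +ℕ q) ≔ conℕ 2 *ℕ (n +ℕ n) +ℕ conℕ 2 *ℕ q) refl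
     (#columns k) (2 ℕ.^ k))
  (trans (cong (λ m → 2 ℕ.* m ℕ.+ 2 ℕ.* 2 ℕ.^ k) (2#columns≡ k))
    (solveℕ 2 (λ k q → conℕ 2 *ℕ ((conℕ 2 +ℕ k) *ℕ q) +ℕ conℕ 2 *ℕ q ≔ (conℕ 3 +ℕ k) *ℕ (conℕ 2 *ℕ q)) refl
       k (2 ℕ.^ k)))

#rows-suc : ∀ k → #rows (suc k) ≡ 12 ℕ.* (2 ℕ.^ k ℕ.* 2 ℕ.^ k)
#rows-suc k = trans
  (cong (2 ℕ.^ suc (suc k) ℕ.* 2 ℕ.^ suc k ℕ.+_) (ℕ.^-distribˡ-+-* 2 (suc k) (suc k)))
  (solveℕ 1 (λ q → conℕ 2 *ℕ (conℕ 2 *ℕ q) *ℕ (conℕ 2 *ℕ q) +ℕ (conℕ 2 *ℕ q) *ℕ (conℕ 2 *ℕ q) ≔ conℕ 12 *ℕ (q *ℕ q))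
     refl (2 ℕ.^ k))

#columns>0 : ∀ k → 1 ≤ #columns k
#columns>0 zero    = ℕ.≤-refl
#columns>0 (suc k) = ℕ.≤-trans (ℕ.m^n>0 2 k) (ℕ.m≤n+m _ (#columns k ℕ.+ #columns k))

-- Bounds the logarithm of every `d` within the capacity by 3k.
capacity≤2^3k : ∀ k → 2 ℕ.^ k ℕ.* #columns k ≤ 2 ℕ.^ (3 ℕ.* k)
capacity≤2^3k k = ℕ.≤-trans (ℕ.*-monoʳ-≤ (2 ℕ.^ k) (#columns≤2^k+k k)) (ℕ.≤-reflexive
  (trans (sym (ℕ.^-distribˡ-+-* 2 k (k ℕ.+ k)))
    (cong (2 ℕ.^_) (solveℕ 1 (λ k → k +ℕ (k +ℕ k) ≔ conℕ 3 *ℕ k) refl k))))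

-- Going from `k` to `suc k` multiplies the number of rows only by 4, so a `d` that reaches the
-- capacity at `k` pays for the rows at `suc k`.
#rows-bound : ∀ k {d} → 2 ℕ.^ k ℕ.* #columns k ≤ d → #rows (suc k) ℕ.* (3 ℕ.* suc k) ≤ d ℕ.* 72
#rows-bound k {d} capacity≤d = begin
  #rows (suc k) ℕ.* (3 ℕ.* suc k)
    ≡⟨ cong (ℕ._* (3 ℕ.* suc k)) (#rows-suc k) ⟩
  12 ℕ.* (q ℕ.* q) ℕ.* (3 ℕ.* suc k)
    -- `suc k` is raised to `2 + k`, the factor in the closed form of twice `#columns k`; that
    -- doubling turns 36 into 72.
    ≤⟨ ℕ.*-monoʳ-≤ (12 ℕ.* (q ℕ.* q)) (ℕ.*-monoʳ-≤ 3 (ℕ.n≤1+n (suc k))) ⟩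
  12 ℕ.* (q ℕ.* q) ℕ.* (3 ℕ.* (2 ℕ.+ k))
    ≡⟨ solveℕ 2 (λ q m → conℕ 12 *ℕ (q *ℕ q) *ℕ (conℕ 3 *ℕ m) ≔ conℕ 36 *ℕ (q *ℕ (m *ℕ q))) refl q (2 ℕ.+ k) ⟩
  36 ℕ.* (q ℕ.* ((2 ℕ.+ k) ℕ.* q))
    ≡⟨ cong (λ m → 36 ℕ.* (q ℕ.* m)) (2#columns≡ k) ⟨
  36 ℕ.* (q ℕ.* (#columns k ℕ.+ #columns k))
    ≡⟨ solveℕ 2 (λ q n → conℕ 36 *ℕ (q *ℕ (n +ℕ n)) ≔ (q *ℕ n) *ℕ conℕ 72) refl q (#columns k) ⟩
  q ℕ.* #columns k ℕ.* 72
    ≤⟨ ℕ.*-monoˡ-≤ 72 capacity≤d ⟩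
  d ℕ.* 72 ∎
  where
  open ℕ.≤-Reasoning
  q = 2 ℕ.^ k

suitable-size : ∀ {d} → 2 ≤ d →
  ∃[ k ] d ≤ 2 ℕ.^ k ℕ.* #columns k × #rows k ℕ.* (3 ℕ.* k) ≤ d ℕ.* 72
suitable-size {d} 2≤d
  -- The least sufficient `k` is taken, so that the capacity at the preceding size is below `d`; the
  -- search ends by `d` since 2^d is at least `d`. Size 0 has capacity 1 and is excluded by `2≤d`.
  with least (λ k → d ℕ.≤? 2 ℕ.^ k ℕ.* #columns k) d
         (ℕ.≤-trans (n≤2^n d) (ℕ.m≤m*n (2 ℕ.^ d) (#columns d) {{>-nonZero (#columns>0 d)}}))
... | zero  , d≤1 , _       = contradiction (ℕ.≤-trans 2≤d d≤1) λ { (s≤s ()) }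
... | suc k , d≤  , minimal = suc k , d≤ , #rows-bound k (ℕ.<⇒≤ (ℕ.≰⇒> λ d≤′ →
  ℕ.<-irrefl refl (minimal k d≤′)))

-- Comparison with the binary logarithm

ℕ→ℚ-homo-* : ∀ m n → ℕ→ℚ m ℚ.* ℕ→ℚ n ≡ ℕ→ℚ (m ℕ.* n)
ℕ→ℚ-homo-* m n = ℚ.toℚᵘ-injective (ℚᵘ.≃-trans (ℚ.toℚᵘ-homo-* (ℕ→ℚ m) (ℕ→ℚ n))
  (ℚᵘ.*≡* (cong (_* 1ℤ) (sym (ℤ.pos-* m n)))))

·-log₂-≤ : ∀ {d n l m} .{{_ : NonZero d}} → d ≤ 2 ℕ.^ l → n ℕ.* l ≤ d ℕ.* m →
           n · log₂ d ≤ʳ d · fromℕ (suc m)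
·-log₂-≤ {d} {n} {l} {m} d≤2^l nl≤dm q (_ , q<nr , r , (t , r<t , 2^t≤d) , refl) =
  -- Lower cuts are strict: `m` lies in the lower cut of `m + 1` but not of `m`, hence `suc m` in
  -- the bound.
  ℕ→ℚ d ℚ.* ℕ→ℚ m , ℚ.<-≤-trans q<nr nr≤dm ,
  ℕ→ℚ m , (ℕ→ℚ (suc m) , ℚ.≰⇒> (ℕ.<⇒≱ (ℕ.n<1+n m) ∘ ℕ→ℚ-cancel-≤) , ℚ.≤-refl) , refl
  where
  open ℚ.≤-Reasoning

  t≤l : t ℚ.≤ ℕ→ℚ l
  t≤l = 2^-≤-trans {d} {t} {ℕ→ℚ l} 2^t≤d
    (subst (ℕ._≤ 2 ℕ.^ l) (sym (trans (ℕ.*-identityʳ _) (ℕ.*-identityʳ d))) d≤2^l)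

  nr≤dm : ℕ→ℚ n ℚ.* r ℚ.≤ ℕ→ℚ d ℚ.* ℕ→ℚ m
  nr≤dm = begin
    ℕ→ℚ n ℚ.* r       ≤⟨ ℚ.*-monoˡ-≤-nonNeg (ℕ→ℚ n) (ℚ.≤-trans (ℚ.<⇒≤ r<t) t≤l) ⟩
    ℕ→ℚ n ℚ.* ℕ→ℚ l   ≡⟨ ℕ→ℚ-homo-* n l ⟩
    ℕ→ℚ (n ℕ.* l)     ≤⟨ ℕ→ℚ-mono-≤ nl≤dm ⟩
    ℕ→ℚ (d ℕ.* m)     ≡⟨ ℕ→ℚ-homo-* d m ⟨
    ℕ→ℚ d ℚ.* ℕ→ℚ m   ∎

mainTheorem3 : Σ[ c ∈ ℝ ] ((d : ℕ) (2≤d : 2 ≤ d) →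
    box (hypercube d) · log₂ d {{>-nonZero (<⇒≤ 2≤d)}} ≤ʳ d · c)
-- The 72 of `suitable-size` plus the 1 that the strict cuts cost.
mainTheorem3 = fromℕ 73 , bound
  where
  bound : (d : ℕ) (2≤d : 2 ≤ d) →
          box (hypercube d) · log₂ d {{>-nonZero (<⇒≤ 2≤d)}} ≤ʳ d · fromℕ 73
  bound d 2≤d with suitable-size 2≤d
  ... | k , d≤capacity , rows≤ = ·-log₂-≤ {{>-nonZero (<⇒≤ 2≤d)}}
    (ℕ.≤-trans d≤capacity (capacity≤2^3k k))
    (ℕ.≤-trans (ℕ.*-monoˡ-≤ (3 ℕ.* k) box≤rows) rows≤)
    where
    box≤rows : box (hypercube d) ≤ #rows k
    box≤rows = proj₂ (box-isBoxicity (hypercube d)) (#rows k) (hypercube-boxes k d≤capacity)
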